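{- Let $n\geq 2$ and $m \geq 2$ be integers, let $\mathcal{W}$ be a vector space over a field $\mathbb{F}$ with $\operatorname{Char}(\mathbb{F})=0$ or $\operatorname{Char}(\mathbb{F})>m$, let $E=\{v_a : a \in [n]\}$ be a multiset of non-zero vectors in $\mathcal{W}$ with $\operatorname{k-rank}(v_a : a \in [n]) \geq 2$, and let $d=\dim\operatorname{span}\{v_a : a \in [n]\}$. Then for any non-negative integer $r$, multiset of non-zero vectors $F=\{u_a : a \in [r]\}\subseteq\mathcal{W}$ with $\operatorname{k-rank}(u_a : a \in [r]) \geq \min\{2,r\}$, and multisets of non-zero scalars $\{\alpha_a : a \in [n]\}, \{\beta_a: a \in [r]\} \subseteq \mathbb{F}^\times$ such that $\{\alpha_a v_a^{\otimes m} : a \in [n]\} \neq \{\beta_a u_a^{\otimes m} : a \in [r]\}$ (as multisets) and $\sum_{a \in [n]} \alpha_a v_a^{\otimes m} = \sum_{a \in [r]} \beta_a u_a^{\otimes m}$, it holds that $n+ r \geq m+2d-2$.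
   Context: $[n]=\{1,\dots,n\}$, $[0]=\emptyset$. The Kruskal rank $\operatorname{k-rank}$ of a multiset of vectors is the largest $k$ such that every sub-multiset of size $k$ is linearly independent. -}

module Defs where

open import Algebra.Bundles using (CommutativeRing)
open import Algebra.Definitions.RawMonoid using (sum)
open import Algebra.Module.Bundles using (Module)
open import Algebra.Module.Structures.Biased using (IsModuleFromLeft)
open import Data.Fin.Base using (Fin)
import Data.List.Base as List
import Data.List.Relation.Binary.Permutation.Setoid as Permutation
open import Data.Nat.Base using (ℕ; _≤_)
open import Data.Nat.Divisibility.Core using (_∣_)
open import Data.Product.Base using (_×_; _,_; ∃-syntax)
open import Data.Vec.Base using (Vec; replicate; _[_]≔_)
open import Data.Vec.Relation.Binary.Pointwise.Inductive using (Pointwise)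
open import Function.Base using (_∘_)
open import Function.Bundles using (_⇔_)
open import Function.Definitions using (Injective)
open import Level using (Level; _⊔_) renaming (suc to lsuc)
open import Relation.Binary.Bundles using (Setoid)
open import Relation.Binary.PropositionalEquality.Core using (_≡_)

record Field c ℓ : Set (lsuc (c ⊔ ℓ)) where
  field
    commutativeRing : CommutativeRing c ℓ

  open CommutativeRing commutativeRing public

  field
    1≉0     : 1# ≉ 0#
    inverse : ∀ x → x ≉ 0# → ∃[ y ] x * y ≈ 1#

NonZeroScalar : ∀ {c ℓ} (F : Field c ℓ) → Field.Carrier F → Set ℓ
NonZeroScalar F a = a ≉ 0#
  where open Field F

VectorSpace : ∀ {c ℓ} → Field c ℓ → (w ℓw : Level) → Set (c ⊔ ℓ ⊔ lsuc (w ⊔ ℓw))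
VectorSpace F = Module (Field.commutativeRing F)

-- p is the non-negative generator of the kernel of the ring homomorphism ℤ → F.
IsCharacteristic : ∀ {c ℓ} → Field c ℓ → ℕ → Set ℓ
IsCharacteristic F p = ∀ k → (k · 1# ≈ 0#) ⇔ (p ∣ k)
  where
  open Field F
  open import Algebra.Definitions.RawMonoid +-rawMonoid using () renaming (_×_ to _·_)

-- Equality of the multisets underlying two finite families.
SameMultiset : ∀ {a ℓ} (S : Setoid a ℓ) {n r : ℕ} →
               (Fin n → Setoid.Carrier S) → (Fin r → Setoid.Carrier S) → Set (a ⊔ ℓ)
SameMultiset S xs ys = List.tabulate xs ↭ List.tabulate ys
  where open Permutation S using (_↭_)

module _ {c ℓ w ℓw} {R : CommutativeRing c ℓ} (W : Module R w ℓw) where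

  open CommutativeRing R using (Carrier; _≈_; _+_; _*_; -_; 0#; 1#; refl; -‿inverseˡ)
  open Module W

  NonZeroVector : Carrierᴹ → Set ℓw
  NonZeroVector x = x ≉ᴹ 0ᴹ

  ∑ : ∀ {n} → (Fin n → Carrierᴹ) → Carrierᴹ
  ∑ = sum +ᴹ-rawMonoid

  linearCombination : ∀ {n} → (Fin n → Carrier) → (Fin n → Carrierᴹ) → Carrierᴹ
  linearCombination γ v = ∑ (λ i → γ i *ₗ v i)

  LinearlyIndependent : ∀ {n} → (Fin n → Carrierᴹ) → Set (c ⊔ ℓ ⊔ ℓw)
  LinearlyIndependent {n} v =
    (γ : Fin n → Carrier) → linearCombination γ v ≈ᴹ 0ᴹ → ∀ i → γ i ≈ 0#

  Span : ∀ {n} → (Fin n → Carrierᴹ) → Carrierᴹ → Set (c ⊔ ℓw)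
  Span v x = ∃[ γ ] linearCombination γ v ≈ᴹ x

  record IsBasisOf {p} (P : Carrierᴹ → Set p) {d} (b : Fin d → Carrierᴹ)
                   : Set (c ⊔ ℓ ⊔ w ⊔ ℓw ⊔ p) where
    field
      member      : ∀ i → P (b i)
      independent : LinearlyIndependent b
      spanning    : ∀ x → P x → Span b x

  HasDimension : ∀ {p} → (Carrierᴹ → Set p) → ℕ → Set (c ⊔ ℓ ⊔ w ⊔ ℓw ⊔ p)
  HasDimension P d = ∃[ b ] IsBasisOf P {d} b

  -- Sub-multisets of size k are indexed by injections Fin k → Fin n. The bound
  -- k ≤ n is needed because for k > n the condition on injections is vacuous.
  SubfamiliesIndependent : ∀ {n} → (Fin n → Carrierᴹ) → ℕ → Set (c ⊔ ℓ ⊔ ℓw)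
  SubfamiliesIndependent {n} v k =
    k ≤ n ×
    ((f : Fin k → Fin n) → Injective _≡_ _≡_ f → LinearlyIndependent (v ∘ f))

  record IsKruskalRank {n} (v : Fin n → Carrierᴹ) (k : ℕ) : Set (c ⊔ ℓ ⊔ ℓw) where
    field
      holds   : SubfamiliesIndependent v k
      largest : ∀ j → SubfamiliesIndependent v j → j ≤ k

  -- The tensor power W^⊗m: the free module on W^m modulo multilinearity.
  -- Tensor m consists of formal linear combinations of tuples, and _≋_ is the
  -- congruence generated by the module axioms and multilinearity.

  infixl 6 _⊕_
  infixr 7 _⊙_
  infix  4 _≋_

  data Tensor (m : ℕ) : Set (c ⊔ w) where
    ⨂   : Vec Carrierᴹ m → Tensor m
    𝟘   : Tensor m
    _⊕_ : Tensor m → Tensor m → Tensor m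
    _⊙_ : Carrier → Tensor m → Tensor m

  data _≋_ {m : ℕ} : Tensor m → Tensor m → Set (c ⊔ ℓ ⊔ w ⊔ ℓw) where
    ≋-refl  : ∀ {s} → s ≋ s
    ≋-sym   : ∀ {s t} → s ≋ t → t ≋ s
    ≋-trans : ∀ {s t u} → s ≋ t → t ≋ u → s ≋ u

    ⨂-cong : ∀ {xs ys} → Pointwise _≈ᴹ_ xs ys → ⨂ xs ≋ ⨂ ys
    ⊕-cong : ∀ {s s′ t t′} → s ≋ s′ → t ≋ t′ → s ⊕ t ≋ s′ ⊕ t′
    ⊙-cong : ∀ {a b s t} → a ≈ b → s ≋ t → a ⊙ s ≋ b ⊙ t

    ⊕-assoc     : ∀ s t u → (s ⊕ t) ⊕ u ≋ s ⊕ (t ⊕ u)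
    ⊕-comm      : ∀ s t → s ⊕ t ≋ t ⊕ s
    ⊕-identityˡ : ∀ s → 𝟘 ⊕ s ≋ s
    ⊙-zeroˡ     : ∀ s → 0# ⊙ s ≋ 𝟘
    ⊙-zeroʳ     : ∀ a → a ⊙ 𝟘 ≋ 𝟘
    ⊙-identityˡ : ∀ s → 1# ⊙ s ≋ s
    ⊙-assoc     : ∀ a b s → (a * b) ⊙ s ≋ a ⊙ (b ⊙ s)
    ⊙-distribˡ  : ∀ a s t → a ⊙ (s ⊕ t) ≋ a ⊙ s ⊕ a ⊙ t
    ⊙-distribʳ  : ∀ s a b → (a + b) ⊙ s ≋ a ⊙ s ⊕ b ⊙ s

    ⨂-additive    : ∀ xs i x y →
                    ⨂ (xs [ i ]≔ (x +ᴹ y)) ≋ ⨂ (xs [ i ]≔ x) ⊕ ⨂ (xs [ i ]≔ y)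
    ⨂-homogeneous : ∀ xs i a x → ⨂ (xs [ i ]≔ (a *ₗ x)) ≋ a ⊙ ⨂ (xs [ i ]≔ x)

  TensorPower : ℕ → Module R (c ⊔ w) (c ⊔ ℓ ⊔ w ⊔ ℓw)
  TensorPower m = record
    { Carrierᴹ = Tensor m
    ; _≈ᴹ_     = _≋_
    ; _+ᴹ_     = _⊕_
    ; _*ₗ_     = _⊙_
    ; _*ᵣ_     = λ t a → a ⊙ t
    ; 0ᴹ       = 𝟘
    ; -ᴹ_      = neg
    ; isModule = IsModuleFromLeft.isModule {commutativeRing = R} record
      { isLeftModule = record
        { isLeftSemimodule = record
          { +ᴹ-isCommutativeMonoid = record
            { isMonoid = record
              { isSemigroup = record
                { isMagma = record
                  { isEquivalence = record
                    { refl = ≋-refl ; sym = ≋-sym ; trans = ≋-trans }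
                  ; ∙-cong = ⊕-cong
                  }
                ; assoc = ⊕-assoc
                }
              ; identity = ⊕-identityˡ , λ s → ≋-trans (⊕-comm s 𝟘) (⊕-identityˡ s)
              }
            ; comm = ⊕-comm
            }
          ; isPreleftSemimodule = record
            { *ₗ-cong      = ⊙-cong
            ; *ₗ-zeroˡ     = ⊙-zeroˡ
            ; *ₗ-distribʳ  = ⊙-distribʳ
            ; *ₗ-identityˡ = ⊙-identityˡ
            ; *ₗ-assoc     = ⊙-assoc
            ; *ₗ-zeroʳ     = ⊙-zeroʳ
            ; *ₗ-distribˡ  = ⊙-distribˡ
            }
          }
        ; -ᴹ‿cong    = ⊙-cong refl
        ; -ᴹ‿inverse = inverseˡ , λ s → ≋-trans (⊕-comm s (neg s)) (inverseˡ s)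
        }
      }
    }
    where
    neg : Tensor m → Tensor m
    neg t = (- 1#) ⊙ t

    inverseˡ : ∀ s → neg s ⊕ s ≋ 𝟘
    inverseˡ s =
      ≋-trans (⊕-cong ≋-refl (≋-sym (⊙-identityˡ s)))
      (≋-trans (≋-sym (⊙-distribʳ s (- 1#) 1#))
      (≋-trans (⊙-cong (-‿inverseˡ 1#) ≋-refl) (⊙-zeroˡ s)))

  infix 8 _^⊗_

  _^⊗_ : Carrierᴹ → (m : ℕ) → Tensor m
  v ^⊗ m = ⨂ (replicate m v)

  scaledPowers : ∀ {n} (m : ℕ) → (Fin n → Carrier) → (Fin n → Carrierᴹ) → Fin n → Tensor m
  scaledPowers m α v a = α a ⊙ v a ^⊗ m

{-# OPTIONS --safe #-}

module Submission where

-- Terms of the two sums with proportional vectors are merged. If s pairs cancel completely, there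
-- remains a non-empty relation ∑ γₜ wₜ^⊗m = 0 with pairwise independent wₜ and γₜ ≠ 0, of length
-- N ≤ n + r − 2s, and d ≤ D + s where D = dim span {wₜ}. It suffices to show N ≥ m − 2 + 2D, which
-- follows by pairing the relation with a product of m functionals that vanishes at all wₜ but one:
-- choose a basis I among the wₜ and divide the others into J and R with |J| = m − 2 (or R empty).
-- If |R| < D, some functional ψ kills R but not wᵢ for some i ∈ I. The product consists of ψ, the
-- functional dual to i in the basis I, and for each j ∈ J one that kills wⱼ but not wᵢ.
--
-- Equality need not be decidable, but the conclusion is a decidable statement about ℕ, so the
-- classical case distinctions are made under a double negation. Since W need not have a basis,
-- functionals are only defined on the span of the finitely many vectors that occur in the given
-- derivation of the equality of tensors.

open import Defs
open import Algebra.Bundles using (CommutativeRing; Monoid; Semiring)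
import Algebra.Definitions.RawSemiring as RawSemiring
open import Algebra.Module.Bundles using (Module)
open import Data.Fin.Base using (Fin; zero; suc; punchIn; punchOut; inject≤)
open import Data.Fin.Properties using (punchIn-injective; punchInᵢ≢i; punchIn-punchOut; suc-injective; inject≤-injective) renaming (_≟_ to _≟ᶠ_)
open import Data.List.Base using (List; []; _∷_; _++_; length; lookup; map; take; drop; tabulate)
open import Data.List.Membership.Propositional.Properties using (∈-lookup)
open import Data.List.Properties using (length-map; length-++; length-take; length-drop; length-tabulate; take++drop≡id)
import Data.List.Relation.Binary.Permutation.Homogeneous as Homogeneous
open import Data.List.Relation.Binary.Permutation.Propositional using (_↭_; prep; swap; ↭-refl; ↭-sym; ↭-trans; ↭⇒↭ₛ; ↭⇒↭ₛ′)
open import Data.List.Relation.Binary.Permutation.Propositional.Properties using (All-resp-↭; ↭-length; map⁺; shift)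
import Data.List.Relation.Binary.Permutation.Setoid.Properties as PermutationSetoid
open import Data.List.Relation.Binary.Pointwise as Pointwise using (Pointwise; []; _∷_)
open import Data.List.Relation.Unary.All as All using (All; []; _∷_)
import Data.List.Relation.Unary.All.Properties as All
open import Data.List.Relation.Unary.AllPairs using (AllPairs; []; _∷_)
import Data.List.Relation.Unary.AllPairs.Properties as AllPairs
open import Data.Nat.Base as ℕ using (ℕ; zero; suc; _⊓_; _≥_; _>_; _∸_; s≤s; z≤n)
import Data.Nat.Properties as ℕ
open import Data.Nat.Solver using (module +-*-Solver)
open import Data.Product.Base using (_×_; _,_; ∃-syntax; proj₁; proj₂)
open import Data.Sum.Base using (_⊎_; inj₁; inj₂)
open import Data.Unit.Base using (⊤; tt)
open import Data.Vec.Base using (Vec; []; _∷_; replicate; toList; _[_]≔_)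
import Data.Vec.Functional as Functional
open import Data.Vec.Relation.Binary.Pointwise.Inductive as VecPointwise using ([]; _∷_)
open import Data.Vec.Relation.Unary.All as VecAll using ([]; _∷_)
open import Data.Vec.Relation.Unary.All.Properties using (toList⁻)
open import Function.Base using (_∘_)
open import Function.Definitions using (Injective)
open import Level using (Lift; lift; _⊔_) renaming (suc to lsuc)
open import Relation.Binary.PropositionalEquality as ≡ using (_≡_; _≢_)
open import Relation.Nullary.Decidable.Core using (yes; no; ¬¬-excluded-middle; decidable-stable)
open import Relation.Nullary.Negation.Core using (¬_; ¬¬-map; contradiction)
open +-*-Solver using (solve; _:+_; _:*_; _:=_; con)

-- Double negation, lists and arithmetic

_>>=_ : ∀ {a b} {A : Set a} {B : Set b} → ¬ ¬ A → (A → ¬ ¬ B) → ¬ ¬ B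
(¬¬a >>= f) ¬b = ¬¬a λ a → f a ¬b

return : ∀ {a} {A : Set a} → A → ¬ ¬ A
return a ¬a = ¬a a

AllPairs-++⁻ : ∀ {a r} {A : Set a} {R : A → A → Set r} xs {ys} →
               AllPairs R (xs ++ ys) → All (λ x → All (R x) ys) xs
AllPairs-++⁻ []       _        = []
AllPairs-++⁻ (x ∷ xs) (p ∷ ps) = All.++⁻ʳ xs p ∷ AllPairs-++⁻ xs ps

All-lookup⁻ : ∀ {a p} {A : Set a} {P : A → Set p} xs → (∀ i → P (lookup xs i)) → All P xs
All-lookup⁻ []       f = []
All-lookup⁻ (x ∷ xs) f = f zero ∷ All-lookup⁻ xs (f ∘ suc)

-- Applied with i = |I| and o = |J| + |R|, so that `o ∸ m` is the size of R. Positivity of `i`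
-- serves the case o ≤ m, where the subtraction truncates to 0.
∸-bound : ∀ m i o → 0 ℕ.< i → i ℕ.+ o ℕ.< m ℕ.+ 2 ℕ.* i → o ℕ.∸ m ℕ.< i
∸-bound m i o 0<i i+o<m+2i = ℕ.m<n+o⇒m∸n<o o m {{ℕ.>-nonZero 0<i}}
  (ℕ.+-cancelˡ-< i o (m ℕ.+ i) (≡.subst (i ℕ.+ o ℕ.<_)
    (solve 2 (λ m i → m :+ con 2 :* i := i :+ (m :+ i)) ≡.refl m i) i+o<m+2i))

-- A cancelled pair shortens the relation by two and costs at most one dimension, which the factor 2
-- balances.
size-bound : ∀ m i s {d t n} → d ℕ.≤ i ℕ.+ s → m ℕ.+ 2 ℕ.* i ℕ.≤ t → t ℕ.+ 2 ℕ.* s ℕ.≤ n → m ℕ.+ 2 ℕ.* d ℕ.≤ n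
size-bound m i s {d} {t} {n} d≤i+s m+2i≤t t+2s≤n = begin
  m ℕ.+ 2 ℕ.* d                  ≤⟨ ℕ.+-monoʳ-≤ m (ℕ.*-monoʳ-≤ 2 d≤i+s) ⟩
  m ℕ.+ 2 ℕ.* (i ℕ.+ s)          ≡⟨ solve 3 (λ m i s → m :+ con 2 :* (i :+ s) := m :+ con 2 :* i :+ con 2 :* s) ≡.refl m i s ⟩
  m ℕ.+ 2 ℕ.* i ℕ.+ 2 ℕ.* s      ≤⟨ ℕ.+-monoˡ-≤ (2 ℕ.* s) m+2i≤t ⟩
  t ℕ.+ 2 ℕ.* s                  ≤⟨ t+2s≤n ⟩
  n                              ∎
  where open ℕ.≤-Reasoning

-- Finite sums with at most one non-zero term

module _ {a ℓ} (M : Monoid a ℓ) where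
  open Monoid M renaming (_∙_ to _+_; ε to 0#; ∙-cong to +-cong; ∙-congˡ to +-congˡ)
  open import Algebra.Properties.Monoid.Sum M using (sum; sum-cong-≋; sum-replicate-zero)

  sum-zero : ∀ {n} (f : Fin n → Carrier) → (∀ i → f i ≈ 0#) → sum f ≈ 0#
  sum-zero {n} f f≈0 = trans (sum-cong-≋ f≈0) (sum-replicate-zero n)

  sum-single : ∀ {n} (f : Fin n → Carrier) i → (∀ j → i ≢ j → f j ≈ 0#) → sum f ≈ f i
  sum-single f zero    f≈0 =
    trans (+-congˡ (sum-zero (f ∘ suc) λ j → f≈0 (suc j) λ ())) (identityʳ _)
  sum-single f (suc i) f≈0 =
    trans (+-cong (f≈0 zero λ ()) (sum-single (f ∘ suc) i λ j i≢j → f≈0 (suc j) (i≢j ∘ suc-injective)))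
          (identityˡ _)

-- Linear algebra in coordinates over a field with stable equality

module StableField {c ℓ} (F : Field c ℓ)
  (stable : ∀ {x y} → ¬ ¬ Field._≈_ F x y → Field._≈_ F x y) where

  open Field F hiding (zero)
  open import Algebra.Properties.Ring ring
    using (-‿distribˡ-*; -‿involutive; -0#≈0#; +-inverseˡ-unique)
  open import Algebra.Definitions.RawMonoid +-rawMonoid using (sum)
  open RawSemiring (Semiring.rawSemiring semiring) using (_^_)
  open import Algebra.Properties.Monoid.Sum +-monoid using (sum-cong-≋)
  open import Algebra.Properties.CommutativeMonoid.Sum +-commutativeMonoid using (∑-distrib-+)
  open import Algebra.Properties.Semiring.Sum semiring using (*-distribˡ-sum)
  open import Algebra.Properties.CommutativeSemigroup +-commutativeSemigroup
    using (interchange; x∙yz≈y∙xz)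
  open import Algebra.Properties.CommutativeSemigroup *-commutativeSemigroup
    using () renaming (x∙yz≈y∙xz to *-x∙yz≈y∙xz; interchange to *-interchange)
  open import Relation.Binary.Reasoning.Setoid setoid

  *-nonzero : ∀ {x y} → x ≉ 0# → y ≉ 0# → x * y ≉ 0#
  *-nonzero {x} {y} x≉0 y≉0 xy≈0 = let x⁻¹ , xx⁻¹≈1 = inverse x x≉0 in y≉0 (begin
    y              ≈⟨ *-identityˡ y ⟨
    1# * y         ≈⟨ *-congʳ (trans (*-comm x⁻¹ x) xx⁻¹≈1) ⟨
    x⁻¹ * x * y    ≈⟨ *-assoc x⁻¹ x y ⟩
    x⁻¹ * (x * y)  ≈⟨ *-congˡ xy≈0 ⟩
    x⁻¹ * 0#       ≈⟨ zeroʳ x⁻¹ ⟩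
    0#             ∎)

  divide : ∀ x y → y ≉ 0# → ∃[ a ] a * y ≈ x
  divide x y y≉0 = let y⁻¹ , yy⁻¹≈1 = inverse y y≉0 in x * y⁻¹ , (begin
    x * y⁻¹ * y    ≈⟨ *-assoc x y⁻¹ y ⟩
    x * (y⁻¹ * y)  ≈⟨ *-congˡ (trans (*-comm y⁻¹ y) yy⁻¹≈1) ⟩
    x * 1#         ≈⟨ *-identityʳ x ⟩
    x              ∎)

  eliminate : ∀ x y → y ≉ 0# → ∃[ a ] x + a * y ≈ 0#
  eliminate x y y≉0 = let a , ay≈x = divide x y y≉0 in - a , (begin
    x + - a * y    ≈⟨ +-congˡ (-‿distribˡ-* a y) ⟨
    x + - (a * y)  ≈⟨ +-congˡ (-‿cong ay≈x) ⟩
    x + - x        ≈⟨ -‿inverseʳ x ⟩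
    0#             ∎)

  -- Excluded middle is applied to the existence of a non-zero value; stability turns its absence
  -- into the equations `f i ≈ 0#`.
  zero-or-nonzero : ∀ {a} {A : Set a} (f : A → Carrier) →
                    ¬ ¬ ((∀ i → f i ≈ 0#) ⊎ ∃[ i ] f i ≉ 0#)
  zero-or-nonzero f = do
    no none ← ¬¬-excluded-middle where yes some → return (inj₂ some)
    return (inj₁ λ i → stable λ fi≉0 → none (i , fi≉0))

  module _ {k : ℕ} where

    Vector : Set c
    Vector = Fin k → Carrier

    infix 8 _•_

    _•_ : Vector → Vector → Carrier
    ψ • x = sum λ p → ψ p * x p

    •-congʳ : ∀ ψ {x y} → (∀ p → x p ≈ y p) → ψ • x ≈ ψ • y
    •-congʳ ψ x≈y = sum-cong-≋ λ p → *-congˡ (x≈y p)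

    •-comm : ∀ ψ x → ψ • x ≈ x • ψ
    •-comm ψ x = sum-cong-≋ λ p → *-comm (ψ p) (x p)

    •-additiveʳ : ∀ ψ x y → ψ • (λ p → x p + y p) ≈ ψ • x + ψ • y
    •-additiveʳ ψ x y = trans (sum-cong-≋ λ p → distribˡ (ψ p) (x p) (y p)) (∑-distrib-+ (λ p → ψ p * x p) (λ p → ψ p * y p))

    •-homogeneousʳ : ∀ ψ a x → ψ • (λ p → a * x p) ≈ a * ψ • x
    •-homogeneousʳ ψ a x = trans (sum-cong-≋ λ p → *-x∙yz≈y∙xz (ψ p) a (x p))
      (sym (*-distribˡ-sum a (λ p → ψ p * x p)))

    _⊹_·_ : Vector → Carrier → Vector → Vector
    (ψ ⊹ a · χ) p = ψ p + a * χ p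

    ⊹-• : ∀ ψ a χ x → (ψ ⊹ a · χ) • x ≈ ψ • x + a * χ • x
    ⊹-• ψ a χ x = begin
      (ψ ⊹ a · χ) • x                ≈⟨ •-comm (ψ ⊹ a · χ) x ⟩
      x • (ψ ⊹ a · χ)                ≈⟨ •-additiveʳ x ψ (λ p → a * χ p) ⟩
      x • ψ + x • (λ p → a * χ p)    ≈⟨ +-cong (•-comm x ψ) (•-homogeneousʳ x a χ) ⟩
      ψ • x + a * x • χ              ≈⟨ +-congˡ (*-congˡ (•-comm x χ)) ⟩
      ψ • x + a * χ • x              ∎

    ⊹-•-absorb : ∀ ψ a χ {x} → χ • x ≈ 0# → (ψ ⊹ a · χ) • x ≈ ψ • x
    ⊹-•-absorb ψ a χ {x} χx≈0 = begin
      (ψ ⊹ a · χ) • x    ≈⟨ ⊹-• ψ a χ x ⟩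
      ψ • x + a * χ • x  ≈⟨ +-congˡ (trans (*-congˡ χx≈0) (zeroʳ a)) ⟩
      ψ • x + 0#         ≈⟨ +-identityʳ _ ⟩
      ψ • x              ∎

    -- Dual systems and annihilating functionals

    -- Biorthogonality without normalisation: a non-zero diagonal already forces the `w i` to be
    -- independent and permits elimination.
    Dual : ∀ {e} → (w c : Fin e → Vector) → Set ℓ
    Dual w c = (∀ i → c i • w i ≉ 0#) × (∀ i j → i ≢ j → c i • w j ≈ 0#)

    -- `ψ` serves as the functional of the new vector. Each old `c i` is corrected by a multiple of
    -- `ψ` so as to vanish at `w zero`; since `ψ` kills the old vectors, the values of `c i` there
    -- do not change.
    Dual-cons : ∀ {e} (w : Fin (suc e) → Vector) c → Dual (w ∘ suc) c →
                ∀ ψ → ψ • w zero ≉ 0# → (∀ i → ψ • w (suc i) ≈ 0#) → ∃[ c′ ] Dual w c′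
    Dual-cons w c (diag , off) ψ ψw₀≉0 ψw≈0 = c′ , diag′ , off′
      where
      a : ∀ i → ∃[ a ] c i • w zero + a * ψ • w zero ≈ 0#
      a i = eliminate _ _ ψw₀≉0
      c′ : Fin _ → Vector
      c′ zero    = ψ
      c′ (suc i) = c i ⊹ proj₁ (a i) · ψ
      diag′ : ∀ i → c′ i • w i ≉ 0#
      diag′ zero    = ψw₀≉0
      diag′ (suc i) = diag i ∘ trans (sym (⊹-•-absorb (c i) _ ψ (ψw≈0 i)))
      off′ : ∀ i j → i ≢ j → c′ i • w j ≈ 0#
      off′ zero    zero    i≢j = contradiction ≡.refl i≢j
      off′ zero    (suc j) i≢j = ψw≈0 j
      off′ (suc i) zero    i≢j = trans (⊹-• (c i) _ ψ (w zero)) (proj₂ (a i))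
      off′ (suc i) (suc j) i≢j =
        trans (⊹-•-absorb (c i) _ ψ (ψw≈0 j)) (off i j (i≢j ∘ ≡.cong suc))

    -- ψ is found in the span of c, which is what the last conclusion records.
    annihilator : (R : List Vector) → ∀ {e} (w c : Fin e → Vector) → Dual w c → length R ℕ.< e →
      ¬ ¬ (∃[ ψ ] (∃[ i ] ψ • w i ≉ 0#) × All (λ y → ψ • y ≈ 0#) R ×
           (∀ y → (∀ i → c i • y ≈ 0#) → ψ • y ≈ 0#))
    annihilator []      {suc e} w c (diag , off) _ =
      return (c zero , (zero , diag zero) , [] , λ y cy≈0 → cy≈0 zero)
    annihilator (y ∷ R) {suc e} w c (diag , off) R<e@(s≤s R<e′) = do
      -- If all `c i` kill `y`, so does every functional in their span, and `y` can be left out.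
      -- Otherwise `c p` is a pivot: multiples of it are added to the other functionals to make them
      -- kill `y`. As `c p` vanishes at the other vectors of `w`, these keep a dual system, and both
      -- `R` and the system lose one element.
      inj₂ (p , cₚy≉0) ← zero-or-nonzero (λ i → c i • y)
        where inj₁ cy≈0 → do
                ψ , ψw≉0 , ψR≈0 , ψ∈c ← annihilator R w c (diag , off) (ℕ.<-trans (ℕ.n<1+n _) R<e)
                return (ψ , ψw≉0 , ψ∈c y cy≈0 ∷ ψR≈0 , ψ∈c)
      let a  = λ j → eliminate (c (punchIn p j) • y) (c p • y) cₚy≉0
          c′ = λ j → c (punchIn p j) ⊹ proj₁ (a j) · c p
          diag′ = λ j → diag (punchIn p j) ∘ trans (sym
                    (⊹-•-absorb (c (punchIn p j)) (proj₁ (a j)) (c p) (off p (punchIn p j) (punchInᵢ≢i p j ∘ ≡.sym))))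
          off′  = λ i j i≢j → trans
                    (⊹-•-absorb (c (punchIn p i)) (proj₁ (a i)) (c p) (off p (punchIn p j) (punchInᵢ≢i p j ∘ ≡.sym)))
                    (off (punchIn p i) (punchIn p j) (i≢j ∘ punchIn-injective p i j))
      ψ , (i , ψwᵢ≉0) , ψR≈0 , ψ∈c′ ← annihilator R (w ∘ punchIn p) c′ (diag′ , off′) R<e′
      return (ψ , (punchIn p i , ψwᵢ≉0)
                , ψ∈c′ y (λ j → trans (⊹-• (c (punchIn p j)) (proj₁ (a j)) (c p) y) (proj₂ (a j))) ∷ ψR≈0
                , λ z cz≈0 → ψ∈c′ z λ j →
                    trans (⊹-•-absorb (c (punchIn p j)) (proj₁ (a j)) (c p) (cz≈0 p)) (cz≈0 (punchIn p j)))

    -- Separation and proportionality of two vectors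

    Separated : Vector → Vector → Set (c ⊔ ℓ)
    Separated x y = ∃[ ψ ] ψ • x ≈ 0# × ψ • y ≉ 0#

    infix 4 _⋕_

    -- Linear independence of a pair, in terms of functionals. Both directions are required, since
    -- `Separated x y` also holds when x is zero and y is not.
    _⋕_ : Vector → Vector → Set (c ⊔ ℓ)
    x ⋕ y = ¬ ¬ Separated x y × ¬ ¬ Separated y x

    ⋕-sym : ∀ {x y} → x ⋕ y → y ⋕ x
    ⋕-sym (p , q) = q , p

    Nonzero : Vector → Set (c ⊔ ℓ)
    Nonzero x = ¬ ¬ (∃[ ψ ] ψ • x ≉ 0#)

    _∥_ : Vector → Vector → Set (c ⊔ ℓ)
    y ∥ x = ∃[ μ ] ∀ p → y p ≈ μ * x p

    unit : Fin k → Vector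
    unit p q with p ≟ᶠ q
    ... | yes _ = 1#
    ... | no  _ = 0#

    unit-self : ∀ p → unit p p ≡ 1#
    unit-self p with p ≟ᶠ p
    ... | yes _   = ≡.refl
    ... | no  p≢p = contradiction ≡.refl p≢p

    unit-other : ∀ p q → p ≢ q → unit p q ≡ 0#
    unit-other p q p≢q with p ≟ᶠ q
    ... | yes p≡q = contradiction p≡q p≢q
    ... | no  _   = ≡.refl

    unit-• : ∀ p (x : Vector) → unit p • x ≈ x p
    unit-• p x = begin
      unit p • x      ≈⟨ sum-single +-monoid (λ q → unit p q * x q) p (λ q p≢q →
                           trans (*-congʳ (reflexive (unit-other p q p≢q))) (zeroˡ _)) ⟩
      unit p p * x p  ≡⟨ ≡.cong (_* x p) (unit-self p) ⟩
      1# * x p        ≈⟨ *-identityˡ _ ⟩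
      x p             ∎

    Nonzero-intro : ∀ {x : Vector} → ¬ (∀ p → x p ≈ 0#) → Nonzero x
    Nonzero-intro {x} x≉0 = do
      inj₂ (p , xp≉0) ← zero-or-nonzero x where inj₁ x≈0 → contradiction x≈0 x≉0
      return (unit p , xp≉0 ∘ trans (sym (unit-• p x)))

    •-zeroʳ : ∀ (ψ : Vector) {x} → (∀ p → x p ≈ 0#) → ψ • x ≈ 0#
    •-zeroʳ ψ {x} x≈0 = sum-zero +-monoid _ λ p → trans (*-congˡ (x≈0 p)) (zeroʳ _)

    -- If `x p` is non-zero, the functionals e_q - (x_q / x_p) e_p all kill `x`. Were all of them to
    -- kill `y` as well, `y` would be (y_p / x_p) x.
    ∦⇒Separated : ∀ {x y : Vector} → Nonzero x → ¬ (y ∥ x) → ¬ ¬ Separated x y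
    ∦⇒Separated {x} {y} x≉0 y∦x = do
      inj₂ (p , xp≉0) ← zero-or-nonzero x
        where inj₁ x≈0 → do
                ψ , ψx≉0 ← x≉0
                contradiction (•-zeroʳ ψ x≈0) ψx≉0
      let a = λ q → eliminate (x q) (x p) xp≉0
          ψ = λ q → unit q ⊹ proj₁ (a q) · unit p
          μ , μxp≈yp = divide (y p) (x p) xp≉0
          ψ• = λ q z → trans (⊹-• (unit q) (proj₁ (a q)) (unit p) z) (+-cong (unit-• q z) (*-congˡ (unit-• p z)))
      inj₂ (q , ψy≉0) ← zero-or-nonzero (λ q → ψ q • y)
        where inj₁ ψy≈0 → contradiction (μ , λ q → begin
                y q                        ≈⟨ +-inverseˡ-unique _ _ (trans (sym (ψ• q y)) (ψy≈0 q)) ⟩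
                - (proj₁ (a q) * y p)      ≈⟨ -‿cong (*-congˡ μxp≈yp) ⟨
                - (proj₁ (a q) * (μ * x p)) ≈⟨ +-inverseˡ-unique _ _ (begin
                  μ * x q + proj₁ (a q) * (μ * x p)  ≈⟨ +-congˡ (*-x∙yz≈y∙xz _ μ (x p)) ⟩
                  μ * x q + μ * (proj₁ (a q) * x p)  ≈⟨ distribˡ μ _ _ ⟨
                  μ * (x q + proj₁ (a q) * x p)      ≈⟨ *-congˡ (proj₂ (a q)) ⟩
                  μ * 0#                             ≈⟨ zeroʳ μ ⟩
                  0#                                 ∎) ⟨
                μ * x q                    ∎) y∦x
      return (ψ q , trans (ψ• q x) (proj₂ (a q)) , ψy≉0)

    ∥⇒• : ∀ {x y : Vector} ((μ , _) : y ∥ x) ψ → ψ • y ≈ μ * ψ • x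
    ∥⇒• (μ , y≈μx) ψ = trans (•-congʳ ψ y≈μx) (•-homogeneousʳ ψ μ _)

    ∥-nonzero : ∀ {x y : Vector} ((μ , _) : y ∥ x) → Nonzero y → μ ≉ 0#
    ∥-nonzero y∥x y≉0 μ≈0 = y≉0 λ (ψ , ψy≉0) →
      ψy≉0 (trans (∥⇒• y∥x ψ) (trans (*-congʳ μ≈0) (zeroˡ _)))

    ∥-sym : ∀ {x y : Vector} → Nonzero y → y ∥ x → x ∥ y
    ∥-sym {x} {y} y≉0 y∥x@(μ , y≈μx) = let a , aμ≈1 = divide 1# μ (∥-nonzero y∥x y≉0) in
      a , λ p → begin
        x p            ≈⟨ *-identityˡ _ ⟨
        1# * x p       ≈⟨ *-congʳ aμ≈1 ⟨
        a * μ * x p    ≈⟨ *-assoc a μ _ ⟩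
        a * (μ * x p)  ≈⟨ *-congˡ (y≈μx p) ⟨
        a * y p        ∎

    ∦⇒⋕ : ∀ {x y : Vector} → Nonzero x → Nonzero y → ¬ (y ∥ x) → x ⋕ y
    ∦⇒⋕ x≉0 y≉0 y∦x = ∦⇒Separated x≉0 y∦x , ∦⇒Separated y≉0 (y∦x ∘ ∥-sym x≉0)

    ∥-⋕ : ∀ {x y z : Vector} → Nonzero y → y ∥ x → y ⋕ z → x ⋕ z
    ∥-⋕ {x} {y} y≉0 y∥x@(μ , _) (y|z , z|y) =
      (do ψ , ψy≈0 , ψz≉0 ← y|z
          return (ψ , stable (λ ψx≉0 → *-nonzero (∥-nonzero y∥x y≉0) ψx≉0 (trans (sym (∥⇒• y∥x ψ)) ψy≈0)) , ψz≉0)) ,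
      (do ψ , ψz≈0 , ψy≉0 ← z|y
          return (ψ , ψz≈0 , λ ψx≈0 → ψy≉0 (trans (∥⇒• y∥x ψ) (trans (*-congˡ ψx≈0) (zeroʳ μ)))))

    -- Products of functionals on sums of powers

    -- The pairing of φ₁ ⊗ ... ⊗ φₘ with the m-th tensor power of `x`.
    eval : ∀ {m} → Vec Vector m → Vector → Carrier
    eval []       x = 1#
    eval (φ ∷ φs) x = φ • x * eval φs x

    eval-∥ : ∀ {m} (φs : Vec Vector m) {x y} ((μ , _) : y ∥ x) → eval φs y ≈ μ ^ m * eval φs x
    eval-∥ []       y∥x = sym (*-identityʳ 1#)
    eval-∥ (φ ∷ φs) y∥x = trans (*-cong (∥⇒• y∥x φ) (eval-∥ φs y∥x)) (*-interchange _ _ _ _)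

    -- Each vector of `J` takes one factor, a functional that kills it but not `x`; the factors left
    -- over are any functionals non-zero at `x`.
    eval-separates : ∀ m (J : List Vector) x → Nonzero x → length J ℕ.≤ m → All (x ⋕_) J →
      ¬ ¬ (∃[ φs ] eval {m} φs x ≉ 0# × All (λ y → eval φs y ≈ 0#) J)
    eval-separates zero    []      x x≉0 _ _ = return ([] , 1≉0 , [])
    eval-separates (suc m) []      x x≉0 _ _ = do
      ψ , ψx≉0 ← x≉0
      φs , φsx≉0 , _ ← eval-separates m [] x x≉0 z≤n []
      return (ψ ∷ φs , *-nonzero ψx≉0 φsx≉0 , [])
    eval-separates (suc m) (y ∷ J) x x≉0 (s≤s J≤m) ((_ , y|x) ∷ x⋕J) = do
      ψ , ψy≈0 , ψx≉0 ← y|x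
      φs , φsx≉0 , φsJ≈0 ← eval-separates m J x x≉0 J≤m x⋕J
      return (ψ ∷ φs , *-nonzero ψx≉0 φsx≉0
             , trans (*-congʳ ψy≈0) (zeroˡ _) ∷ All.map (λ φsz≈0 → trans (*-congˡ φsz≈0) (zeroʳ _)) φsJ≈0)

    -- `(γ , x)` stands for γ x^⊗m, and `total φs` pairs a sum of such terms with φ₁ ⊗ ... ⊗ φₘ.
    Term : Set c
    Term = Carrier × Vector

    term : ∀ {m} → Vec Vector m → Term → Carrier
    term φs (γ , x) = γ * eval φs x

    total : ∀ {m} → Vec Vector m → List Term → Carrier
    total φs []       = 0#
    total φs (t ∷ ts) = term φs t + total φs ts

    total-++ : ∀ {m} (φs : Vec Vector m) ss ts → total φs (ss ++ ts) ≈ total φs ss + total φs ts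
    total-++ φs []       ts = sym (+-identityˡ _)
    total-++ φs (s ∷ ss) ts = trans (+-congˡ (total-++ φs ss ts)) (sym (+-assoc _ _ _))

    total-↭ : ∀ {m} (φs : Vec Vector m) {ss ts} → ss ↭ ts → total φs ss ≈ total φs ts
    total-↭ φs _↭_.refl        = refl
    total-↭ φs (prep t p)      = +-congˡ (total-↭ φs p)
    total-↭ φs (swap s t p)    = trans (+-congˡ (+-congˡ (total-↭ φs p))) (x∙yz≈y∙xz _ _ _)
    total-↭ φs (_↭_.trans p q) = trans (total-↭ φs p) (total-↭ φs q)

    total-zero : ∀ {m} (φs : Vec Vector m) {ts} → All (λ t → eval φs (proj₂ t) ≈ 0#) ts → total φs ts ≈ 0#
    total-zero φs []       = refl
    total-zero φs (p ∷ ps) =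
      trans (+-cong (trans (*-congˡ p) (zeroʳ _)) (total-zero φs ps)) (+-identityʳ 0#)

    total-single : ∀ {m} (φs : Vec Vector m) ts i →
      (∀ j → i ≢ j → eval φs (proj₂ (lookup ts j)) ≈ 0#) → total φs ts ≈ term φs (lookup ts i)
    total-single φs (t ∷ ts) zero    ts≈0 =
      trans (+-congˡ (total-zero φs (All-lookup⁻ ts λ j → ts≈0 (suc j) λ ()))) (+-identityʳ _)
    total-single φs (t ∷ ts) (suc i) ts≈0 =
      trans (+-cong (trans (*-congˡ (ts≈0 zero λ ())) (zeroʳ _))
                    (total-single φs ts i λ j i≢j → ts≈0 (suc j) (i≢j ∘ suc-injective)))
            (+-identityˡ _)

    -- Choice of a basis and the length of a relation with pairwise independent vectors

    Kills : Vector → Term → Set ℓ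
    Kills ψ t = ψ • proj₂ t ≈ 0#

    -- The chosen vectors form a basis of the span of all vectors, in dual form: independence is
    -- witnessed by a dual system, and generation is tested by functionals.
    record Selection (ts : List Term) : Set (c ⊔ ℓ) where
      field
        chosen others : List Term
        partition     : ts ↭ chosen ++ others
        functionals   : Fin (length chosen) → Vector
        dual          : Dual (proj₂ ∘ lookup chosen) functionals
        spans         : ∀ ψ → All (Kills ψ) chosen → All (Kills ψ) ts

    -- Greedy choice from the end of the list: `t` is added when some functional kills the previous
    -- choices but not `t`, which is just what `Dual-cons` needs. If there is none, stability shows
    -- that `t` adds nothing to the span.
    select : ∀ ts → ¬ ¬ Selection ts
    select [] = return record
      { chosen = [] ; others = [] ; partition = ↭-refl ; functionals = λ ()
      ; dual = (λ ()) , (λ ()) ; spans = λ _ _ → [] }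
    select (t ∷ ts) = do
      S ← select ts
      let open Selection S
      ¬¬-excluded-middle {A = ∃[ ψ ] All (Kills ψ) chosen × ¬ Kills ψ t} >>= λ where
        (yes (ψ , ψI≈0 , ψt≉0)) →
          let c′ , dual′ = Dual-cons (proj₂ ∘ lookup (t ∷ chosen)) functionals dual ψ ψt≉0
                             (λ i → All.lookup ψI≈0 (∈-lookup i))
          in return record
            { chosen = t ∷ chosen ; others = others ; partition = prep t partition
            ; functionals = c′ ; dual = dual′
            ; spans = λ { ψ (p ∷ ps) → p ∷ spans ψ ps } }
        (no none) → return record
          { chosen = chosen ; others = t ∷ others
          ; partition = ↭-trans (prep t partition) (↭-sym (shift t chosen others))
          ; functionals = functionals ; dual = dual
          ; spans = λ ψ ψI≈0 → stable (λ ψt≉0 → none (ψ , ψI≈0 , ψt≉0)) ∷ spans ψ ψI≈0 }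

    -- With nothing chosen, `spans` would make every functional kill the first vector.
    chosen-nonempty : ∀ {ts} (S : Selection ts) → ¬ ts ≡ [] → All (Nonzero ∘ proj₂) ts →
                      0 ℕ.< length (Selection.chosen S)
    chosen-nonempty {[]}     S ts≢[] _         = contradiction ≡.refl ts≢[]
    chosen-nonempty {t ∷ ts} S _     (t≉0 ∷ _) with Selection.chosen S | Selection.spans S
    ... | _ ∷ _ | _     = s≤s z≤n
    ... | []    | spans = contradiction (λ (ψ , ψt≉0) → ψt≉0 (All.head (spans ψ []))) t≉0

    _⋕ₜ_ : Term → Term → Set (c ⊔ ℓ)
    s ⋕ₜ t = proj₂ s ⋕ proj₂ t

    AllPairs-⋕-↭ : ∀ {ss ts} → ss ↭ ts → AllPairs _⋕ₜ_ ss → AllPairs _⋕ₜ_ ts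
    AllPairs-⋕-↭ p = PermutationSetoid.AllPairs-resp-↭ (≡.setoid Term) ⋕-sym
      ((λ { ≡.refl q → q }) , (λ { ≡.refl q → q })) (↭⇒↭ₛ p)

    module _ (m : ℕ) {ts : List Term} (S : Selection ts) where
      open Selection S

      -- The tensor degree is `2 + m`: beside `ψ` and the functional dual to `i`, there remain m
      -- factors for J. If the bound failed, |R| < |I| would hold and the product would be non-zero
      -- at a single vector of the relation.
      relation-size : 0 ℕ.< length chosen → AllPairs _⋕ₜ_ ts → All (λ t → proj₁ t ≉ 0#) ts →
        (∀ (φs : Vec Vector (2 ℕ.+ m)) → total φs ts ≈ 0#) →
        m ℕ.+ 2 ℕ.* length chosen ℕ.≤ length ts
      relation-size 0<I ts⋕ ts≉0 relation = decidable-stable (_ ℕ.≤? _) λ small → (do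
        let J = take m others
            R = drop m others
            w = proj₂ ∘ lookup chosen
        ψ , (i , ψi≉0) , ψR≈0 , _ ← annihilator (map proj₂ R) w functionals dual (R<I (ℕ.≰⇒> small))
        let cᵢ = functionals i
            cᵢi≉0 = proj₁ dual i
            i⋕others = All.lookup (AllPairs-++⁻ chosen (AllPairs-⋕-↭ partition ts⋕)) (∈-lookup i)
        φs , φsi≉0 , φsJ≈0 ← eval-separates m (map proj₂ J) (w i) (return (cᵢ , cᵢi≉0))
          (ℕ.≤-trans (ℕ.≤-reflexive (≡.trans (length-map proj₂ J) (length-take m others))) (ℕ.m⊓n≤m m _))
          (All.map⁺ (All.take⁺ m i⋕others))
        -- `φs` kills J, `ψ` kills R and `cᵢ` kills the other chosen vectors, so only the term of
        -- `i` survives.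
        let Φ = ψ ∷ cᵢ ∷ φs
            ΦJ≈0 = All.map (λ φsj≈0 → trans (*-congˡ (trans (*-congˡ φsj≈0) (zeroʳ _))) (zeroʳ _)) (All.map⁻ φsJ≈0)
            ΦR≈0 = All.map (λ ψr≈0 → trans (*-congʳ ψr≈0) (zeroˡ _)) (All.map⁻ ψR≈0)
            Φothers≈0 = ≡.subst (All (λ t → eval Φ (proj₂ t) ≈ 0#)) (take++drop≡id m others) (All.++⁺ ΦJ≈0 ΦR≈0)
            ΦI≈i = total-single Φ chosen i λ j i≢j →
                     trans (*-congˡ (trans (*-congʳ (proj₂ dual i j i≢j)) (zeroˡ _))) (zeroʳ _)
        contradiction (begin
          term Φ (lookup chosen i)             ≈⟨ ΦI≈i ⟨
          total Φ chosen                       ≈⟨ +-identityʳ _ ⟨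
          total Φ chosen + 0#                  ≈⟨ +-congˡ (total-zero Φ Φothers≈0) ⟨
          total Φ chosen + total Φ others      ≈⟨ total-++ Φ chosen others ⟨
          total Φ (chosen ++ others)           ≈⟨ total-↭ Φ partition ⟨
          total Φ ts                           ≈⟨ relation Φ ⟩
          0#                                   ∎)
          (*-nonzero (All.lookup (All.++⁻ˡ chosen (All-resp-↭ partition ts≉0)) (∈-lookup i))
            (*-nonzero ψi≉0 (*-nonzero cᵢi≉0 φsi≉0)))) λ x → x
        where
        R<I : length ts ℕ.< m ℕ.+ 2 ℕ.* length chosen → length (map proj₂ (drop m others)) ℕ.< length chosen
        R<I ts<m+2I = ≡.subst (ℕ._< length chosen)
          (≡.sym (≡.trans (length-map proj₂ (drop m others)) (length-drop m others)))
          (∸-bound m (length chosen) (length others) 0<I (≡.subst (ℕ._< m ℕ.+ 2 ℕ.* length chosen)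
            (≡.trans (↭-length partition) (length-++ chosen)) ts<m+2I))

    -- Merging proportional terms

    find-∥ : ∀ x → Nonzero x → ∀ (ts : List Term) → All (Nonzero ∘ proj₂) ts →
      ¬ ¬ (All (λ t → x ⋕ proj₂ t) ts ⊎ ∃[ t ] ∃[ ts′ ] ts ↭ t ∷ ts′ × proj₂ t ∥ x)
    find-∥ x x≉0 []       []           = return (inj₁ [])
    find-∥ x x≉0 (t ∷ ts) (t≉0 ∷ ts≉0) = do
      no t∦x ← ¬¬-excluded-middle
        where yes t∥x → return (inj₂ (t , ts , ↭-refl , t∥x))
      inj₁ x⋕ts ← find-∥ x x≉0 ts ts≉0
        where inj₂ (s , ts′ , ts↭ , s∥x) →
                return (inj₂ (s , t ∷ ts′ , ↭-trans (prep t ts↭) (swap t s ↭-refl) , s∥x))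
      return (inj₁ (∦⇒⋕ x≉0 t≉0 t∦x ∷ x⋕ts))

    module _ (m : ℕ) where

      infix 4 _~_

      -- With y = μ x, the condition on the coefficients makes β y^⊗m and α x^⊗m agree, so related
      -- terms stand for the same tensor.
      _~_ : Term → Term → Set (c ⊔ ℓ)
      (α , x) ~ (β , y) = ∃[ μ ] (∀ p → y p ≈ μ * x p) × α ≈ β * μ ^ m

      -- The outcome of subtracting ys from xs: proportional terms are merged into a single
      -- term of rest, or recorded in cancelled when they add up to zero.
      record Difference (xs ys : List Term) : Set (lsuc (c ⊔ ℓ)) where
        field
          rest         : List Term
          cancelled    : List Vector
          total-rest   : ∀ (φs : Vec Vector m) → total φs rest + total φs ys ≈ total φs xs
          coefficients : All (λ t → proj₁ t ≉ 0#) rest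
          -- Every vector of `rest` comes from `xs` or `ys`. The predicate `Q` is instantiated with
          -- `Nonzero` and with `x ⋕_`.
          inherit      : ∀ (Q : Vector → Set (c ⊔ ℓ)) → All (Q ∘ proj₂) xs → All (Q ∘ proj₂) ys →
                         All (Q ∘ proj₂) rest
          pairwise     : AllPairs _⋕ₜ_ rest
          size         : length rest ℕ.+ 2 ℕ.* length cancelled ℕ.≤ length xs ℕ.+ length ys
          spans        : ∀ ψ → All (Kills ψ) rest → All (λ x → ψ • x ≈ 0#) cancelled → All (Kills ψ) xs
          -- If `rest` is empty, every term was cancelled against a partner; this is what the
          -- hypothesis of different multisets rules out.
          matched      : rest ≡ [] → ∃[ zs ] ys ↭ zs × Pointwise _~_ xs zs

      private
        negate : Term → Term
        negate (β , y) = - β , y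

        total-negate : ∀ (φs : Vec Vector m) ts → total φs (map negate ts) + total φs ts ≈ 0#
        total-negate φs []             = +-identityʳ 0#
        total-negate φs ((β , y) ∷ ts) = begin
          (- β * e + total φs (map negate ts)) + (β * e + total φs ts)  ≈⟨ interchange _ _ _ _ ⟩
          (- β * e + β * e) + (total φs (map negate ts) + total φs ts)  ≈⟨ +-cong
            (trans (sym (distribʳ e (- β) β)) (trans (*-congʳ (-‿inverseˡ β)) (zeroˡ e))) (total-negate φs ts) ⟩
          0# + 0#                                                      ≈⟨ +-identityʳ 0# ⟩
          0#                                                           ∎
          where e = eval φs y

        AllPairs-negate : ∀ {ts} → AllPairs _⋕ₜ_ ts → AllPairs _⋕ₜ_ (map negate ts)
        AllPairs-negate []       = []
        AllPairs-negate (p ∷ ps) = All.map⁺ p ∷ AllPairs-negate ps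

        -‿nonzero : ∀ {x} → x ≉ 0# → - x ≉ 0#
        -‿nonzero x≉0 -x≈0 = x≉0 (trans (sym (-‿involutive _)) (trans (-‿cong -x≈0) -0#≈0#))

      -- Recursion on `xs`. As the vectors of `ys` are pairwise independent, `x` has at most one
      -- proportional partner `y`. Without a partner the term is kept; otherwise `y` is removed from
      -- `ys` and the two terms merge or cancel. What is left of `ys` at the end is negated.
      difference : ∀ xs ys →
        AllPairs _⋕ₜ_ xs → All (Nonzero ∘ proj₂) xs → All (λ t → proj₁ t ≉ 0#) xs →
        AllPairs _⋕ₜ_ ys → All (Nonzero ∘ proj₂) ys → All (λ t → proj₁ t ≉ 0#) ys →
        ¬ ¬ Difference xs ys
      difference [] ys _ _ _ ys⋕ ys≉0 β≉0 = return record
        { rest         = map negate ys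
        ; cancelled    = []
        ; total-rest   = λ φs → total-negate φs ys
        ; coefficients = All.map⁺ (All.map -‿nonzero β≉0)
        ; inherit      = λ Q _ Qys → All.map⁺ Qys
        ; pairwise     = AllPairs-negate ys⋕
        ; size         = ℕ.≤-reflexive (≡.trans (ℕ.+-identityʳ _) (length-map negate ys))
        ; spans        = λ _ _ _ → []
        ; matched      = matched ys
        }
        where
        matched : ∀ ys → map negate ys ≡ [] → ∃[ zs ] ys ↭ zs × Pointwise _~_ [] zs
        matched [] _ = [] , ↭-refl , []
      difference ((α , x) ∷ xs) ys (x⋕xs ∷ xs⋕) (x≉0 ∷ xs≉0) (α≉0 ∷ αs≉0) ys⋕ ys≉0 β≉0 = do
        inj₂ ((β , y) , ys′ , ys↭ , y∥x) ← find-∥ x x≉0 ys ys≉0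
          where inj₁ x⋕ys → do
                  D ← difference xs ys xs⋕ xs≉0 αs≉0 ys⋕ ys≉0 β≉0
                  let open Difference D
                  return record
                    { rest         = (α , x) ∷ rest
                    ; cancelled    = cancelled
                    ; total-rest   = λ φs → trans (+-assoc _ _ _) (+-congˡ (total-rest φs))
                    ; coefficients = α≉0 ∷ coefficients
                    ; inherit      = λ { Q (Qx ∷ Qxs) Qys → Qx ∷ inherit Q Qxs Qys }
                    ; pairwise     = inherit (x ⋕_) x⋕xs x⋕ys ∷ pairwise
                    ; size         = s≤s size
                    ; spans        = λ { ψ (ψx ∷ ψrest) ψC → ψx ∷ spans ψ ψrest ψC }
                    ; matched      = λ ()
                    }
        case-∥ β y ys′ ys↭ y∥x (AllPairs-⋕-↭ ys↭ ys⋕) (All-resp-↭ ys↭ ys≉0) (All-resp-↭ ys↭ β≉0)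
        where
        case-∥ : ∀ β y ys′ → ys ↭ (β , y) ∷ ys′ → y ∥ x → AllPairs _⋕ₜ_ ((β , y) ∷ ys′) →
                 All (Nonzero ∘ proj₂) ((β , y) ∷ ys′) → All (λ t → proj₁ t ≉ 0#) ((β , y) ∷ ys′) →
                 ¬ ¬ Difference ((α , x) ∷ xs) ys
        case-∥ β y ys′ ys↭ y∥x@(μ , y≈μx) (y⋕ys′ ∷ ys′⋕) (y≉0 ∷ ys′≉0) (_ ∷ β′≉0) = do
          D ← difference xs ys′ xs⋕ xs≉0 αs≉0 ys′⋕ ys′≉0 β′≉0
          let open Difference D
              -- β y^⊗m equals β μ^m x^⊗m, so `δ` is the coefficient of x^⊗m in the difference.
              δ = α + - (β * μ ^ m)
              total-ys = λ φs → trans (total-↭ φs ys↭) (+-congʳ (trans (*-congˡ (eval-∥ φs y∥x)) (sym (*-assoc _ _ _))))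
              suc-length = ≡.sym (↭-length ys↭)
          ¬¬-excluded-middle {A = δ ≈ 0#} >>= λ where
            (no δ≉0) → return record
              { rest         = (δ , x) ∷ rest
              ; cancelled    = cancelled
              ; total-rest   = λ φs → let e = eval φs x ; b = β * μ ^ m in begin
                  (δ * e + total φs rest) + total φs ys               ≈⟨ +-congˡ (total-ys φs) ⟩
                  (δ * e + total φs rest) + (b * e + total φs ys′)    ≈⟨ interchange _ _ _ _ ⟩
                  (δ * e + b * e) + (total φs rest + total φs ys′)    ≈⟨ +-cong (distribʳ e δ b) (sym (total-rest φs)) ⟨
                  (δ + b) * e + total φs xs                           ≈⟨ +-congʳ (*-congʳ (trans (+-assoc α (- b) b)
                      (trans (+-congˡ (-‿inverseˡ b)) (+-identityʳ α)))) ⟩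
                  α * e + total φs xs                                 ∎
              ; coefficients = δ≉0 ∷ coefficients
              ; inherit      = λ { Q (Qx ∷ Qxs) Qys → Qx ∷ inherit Q Qxs (All.tail (All-resp-↭ ys↭ Qys)) }
              -- The remaining vectors of `ys` are independent of `y`, hence of the proportional
              -- vector `x`.
              ; pairwise     = inherit (x ⋕_) x⋕xs (All.map (∥-⋕ y≉0 y∥x) y⋕ys′) ∷ pairwise
              ; size         = s≤s (ℕ.≤-trans size (ℕ.+-monoʳ-≤ (length xs) (ℕ.≤-trans (ℕ.n≤1+n _) (ℕ.≤-reflexive suc-length))))
              ; spans        = λ { ψ (ψx ∷ ψrest) ψC → ψx ∷ spans ψ ψrest ψC }
              ; matched      = λ ()
              }
            (yes δ≈0) → let α≈b = trans (+-inverseˡ-unique _ _ δ≈0) (-‿involutive _) in return record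
              { rest         = rest
              ; cancelled    = x ∷ cancelled
              ; total-rest   = λ φs → let e = eval φs x ; b = β * μ ^ m in begin
                  total φs rest + total φs ys               ≈⟨ +-congˡ (total-ys φs) ⟩
                  total φs rest + (b * e + total φs ys′)    ≈⟨ x∙yz≈y∙xz _ _ _ ⟩
                  b * e + (total φs rest + total φs ys′)    ≈⟨ +-cong (*-congʳ (sym α≈b)) (total-rest φs) ⟩
                  α * e + total φs xs                       ∎
              ; coefficients = coefficients
              ; inherit      = λ { Q (Qx ∷ Qxs) Qys → inherit Q Qxs (All.tail (All-resp-↭ ys↭ Qys)) }
              ; pairwise     = pairwise
              ; size         = ≡.subst₂ ℕ._≤_
                  (solve 2 (λ r s → con 2 :+ (r :+ con 2 :* s) := r :+ con 2 :* (con 1 :+ s)) ≡.refl (length rest) (length cancelled))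
                  (≡.cong suc (≡.trans (≡.sym (ℕ.+-suc (length xs) (length ys′))) (≡.cong (length xs ℕ.+_) suc-length)))
                  (s≤s (s≤s size))
              ; spans        = λ { ψ ψrest (ψx ∷ ψC) → ψx ∷ spans ψ ψrest ψC }
              ; matched      = λ rest≡[] → let zs , ys′↭zs , xs~zs = matched rest≡[] in
                  (β , y) ∷ zs , ↭-trans ys↭ (prep (β , y) ys′↭zs) , (μ , y≈μx , α≈b) ∷ xs~zs
              }

-- Passage to a stable equality

-- Finite double-negation shift: an equality of coordinate vectors arrives one doubly negated
-- coordinate at a time.
¬¬-∀Fin : ∀ {n p} {P : Fin n → Set p} → (∀ i → ¬ ¬ P i) → ¬ ¬ (∀ i → P i)
¬¬-∀Fin {zero}  ¬¬p = return λ ()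
¬¬-∀Fin {suc n} ¬¬p = do
  p₀ ← ¬¬p zero
  p  ← ¬¬-∀Fin (¬¬p ∘ suc)
  return λ { zero → p₀ ; (suc i) → p i }

All-replicate⁺ : ∀ {a p} {A : Set a} {P : A → Set p} {x} m → P x → VecAll.All P (replicate m x)
All-replicate⁺ zero    px = []
All-replicate⁺ (suc m) px = px ∷ All-replicate⁺ m px

-- The double negation of equality is stable, and the operations stay the same. Being non-zero keeps
-- its meaning, as a triple negation is equivalent to a negation. The linear algebra above thus
-- applies to every field.
stableField : ∀ {c ℓ} → Field c ℓ → Field c ℓ
stableField F = record
  { commutativeRing = record
    { _≈_ = λ x y → ¬ ¬ x ≈ y
    ; _+_ = _+_ ; _*_ = _*_ ; -_ = -_ ; 0# = 0# ; 1# = 1#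
    ; isCommutativeRing = record
      { isRing = record
        { +-isAbelianGroup = record
          { isGroup = record
            { isMonoid = record
              { isSemigroup = record
                { isMagma = record
                  { isEquivalence = record
                    { refl = return refl ; sym = ¬¬-map sym ; trans = lift₂ trans }
                  ; ∙-cong = lift₂ +-cong
                  }
                ; assoc = λ x y z → return (+-assoc x y z)
                }
              ; identity = (λ x → return (+-identityˡ x)) , (λ x → return (+-identityʳ x))
              }
            ; inverse = (λ x → return (-‿inverseˡ x)) , (λ x → return (-‿inverseʳ x))
            ; ⁻¹-cong = ¬¬-map -‿cong
            }
          ; comm = λ x y → return (+-comm x y)
          }
        ; *-cong = lift₂ *-cong
        ; *-assoc = λ x y z → return (*-assoc x y z)
        ; *-identity = (λ x → return (*-identityˡ x)) , (λ x → return (*-identityʳ x))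
        ; distrib = (λ x y z → return (distribˡ x y z)) , (λ x y z → return (distribʳ x y z))
        }
      ; *-comm = λ x y → return (*-comm x y)
      }
    }
  ; 1≉0     = return 1≉0
  ; inverse = λ x x≉0 → let y , xy≈1 = inverse x (x≉0 ∘ return) in y , return xy≈1
  }
  where
  open Field F
  lift₂ : ∀ {a b d} {A : Set a} {B : Set b} {D : Set d} → (A → B → D) → ¬ ¬ A → ¬ ¬ B → ¬ ¬ D
  lift₂ f ¬¬a ¬¬b = do
    a ← ¬¬a
    b ← ¬¬b
    return (f a b)

-- Tensor powers and the vectors in a derivation

module _ {c ℓ w ℓw} {R : CommutativeRing c ℓ} (W : Module R w ℓw) where

  open CommutativeRing R using (Carrier) renaming (refl to ≈-refl)
  open RawSemiring (Semiring.rawSemiring (CommutativeRing.semiring R)) using (_^_)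
  open Module W

  private
    -- Generalised from ⨂ to an arbitrary context H, so that H (x ∷ _) is again such a context.
    scale-all : ∀ {m M} (H : Vec Carrierᴹ m → Tensor W M) →
      (∀ xs i a x → _≋_ W (H (xs [ i ]≔ (a *ₗ x))) (a ⊙ H (xs [ i ]≔ x))) →
      ∀ a x → _≋_ W (H (replicate m (a *ₗ x))) (a ^ m ⊙ H (replicate m x))
    scale-all {zero}  H homogeneous a x = ≋-sym (⊙-identityˡ _)
    scale-all {suc m} H homogeneous a x =
      ≋-trans (homogeneous ((a *ₗ x) ∷ replicate m (a *ₗ x)) zero a x)
      (≋-trans (⊙-cong ≈-refl (scale-all (H ∘ (x ∷_)) (λ xs i → homogeneous (x ∷ xs) (suc i)) a x))
      (≋-sym (⊙-assoc _ _ _)))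

  ^⊗-homogeneous : ∀ m a x → _≋_ W (_^⊗_ W (a *ₗ x) m) (a ^ m ⊙ _^⊗_ W x m)
  ^⊗-homogeneous m = scale-all ⨂ ⨂-homogeneous

  ^⊗-cong : ∀ m {x y} → x ≈ᴹ y → _≋_ W (_^⊗_ W x m) (_^⊗_ W y m)
  ^⊗-cong m x≈y = ⨂-cong (replicate⁺ m)
    where
    replicate⁺ : ∀ m → VecPointwise.Pointwise _≈ᴹ_ (replicate m _) (replicate m _)
    replicate⁺ zero    = []
    replicate⁺ (suc m) = x≈y ∷ replicate⁺ m

  vectors : ∀ {m} → Tensor W m → List Carrierᴹ
  vectors (⨂ xs)  = toList xs
  vectors 𝟘       = []
  vectors (s ⊕ t) = vectors s ++ vectors t
  vectors (a ⊙ t) = vectors t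

  -- Only `≋-trans` brings in a tensor that is not visible in the two sides; the premises of the
  -- other rules relate parts of their conclusions. Functionals defined on the two sides and on
  -- these vectors can therefore follow the whole derivation.
  intermediates : ∀ {m} {s t : Tensor W m} → _≋_ W s t → List Carrierᴹ
  intermediates (≋-sym p)             = intermediates p
  intermediates (≋-trans {t = t} p q) = vectors t ++ (intermediates p ++ intermediates q)
  intermediates (⊕-cong p q)          = intermediates p ++ intermediates q
  intermediates (⊙-cong _ p)          = intermediates p
  intermediates _                     = []

  Supported : ∀ {p} (P : Carrierᴹ → Set p) {m} → Tensor W m → Set (w ⊔ p)
  Supported P (⨂ xs)  = VecAll.All P xs
  Supported P 𝟘       = Lift _ ⊤
  Supported P (s ⊕ t) = Supported P s × Supported P t
  Supported P (a ⊙ t) = Supported P t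

  Supported-vectors : ∀ {p} {P : Carrierᴹ → Set p} {m} (t : Tensor W m) → All P (vectors t) → Supported P t
  Supported-vectors (⨂ xs)  ps = toList⁻ ps
  Supported-vectors 𝟘       ps = lift tt
  Supported-vectors (s ⊕ t) ps = let qs , qt = All.++⁻ (vectors s) ps in Supported-vectors s qs , Supported-vectors t qt
  Supported-vectors (a ⊙ t) ps = Supported-vectors t ps

-- Coordinates in a finitely generated part of W

module Coordinates {c ℓ w ℓw} (F : Field c ℓ) (W : VectorSpace F w ℓw) where
  open Field F hiding (zero)
  open Module W
  open import Algebra.Properties.CommutativeMonoid.Sum +ᴹ-commutativeMonoid using (∑-distrib-+; sum-cong-≋)
  open import Relation.Binary.Reasoning.Setoid ≈ᴹ-setoid

  private module Stable = Field (stableField F)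
  open StableField (stableField F) (_>>= λ x≈y → x≈y)

  open RawSemiring (Semiring.rawSemiring semiring) using (_^_)
  open RawSemiring (Semiring.rawSemiring Stable.semiring) using () renaming (_^_ to _^ˢ_)

  ^-stable : ∀ a m → a ^ m ≡ a ^ˢ m
  ^-stable a zero    = ≡.refl
  ^-stable a (suc m) = ≡.cong (a *_) (^-stable a m)

  combination : ∀ {n} → (Fin n → Carrier) → (Fin n → Carrierᴹ) → Carrierᴹ
  combination = linearCombination W

  combination-cong : ∀ {n} (L : Fin n → Carrierᴹ) {ξ ζ} → (∀ i → ξ i ≈ ζ i) → combination ξ L ≈ᴹ combination ζ L
  combination-cong L ξ≈ζ = sum-cong-≋ λ i → *ₗ-congʳ (ξ≈ζ i)

  combination-+ : ∀ {n} (L : Fin n → Carrierᴹ) ξ ζ →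
                  combination (λ i → ξ i + ζ i) L ≈ᴹ combination ξ L +ᴹ combination ζ L
  combination-+ L ξ ζ = ≈ᴹ-trans (sum-cong-≋ λ i → *ₗ-distribʳ (L i) (ξ i) (ζ i))
    (∑-distrib-+ (λ i → ξ i *ₗ L i) (λ i → ζ i *ₗ L i))

  combination-* : ∀ {n} (L : Fin n → Carrierᴹ) a ξ →
                  combination (λ i → a * ξ i) L ≈ᴹ a *ₗ combination ξ L
  combination-* {zero}  L a ξ = ≈ᴹ-sym (*ₗ-zeroʳ a)
  combination-* {suc n} L a ξ = ≈ᴹ-trans
    (+ᴹ-cong (*ₗ-assoc a (ξ zero) (L zero)) (combination-* (L ∘ suc) a (ξ ∘ suc)))
    (≈ᴹ-sym (*ₗ-distribˡ a _ _))

  combination-unit : ∀ {n} (L : Fin n → Carrierᴹ) i → combination (unit i) L ≈ᴹ L i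
  combination-unit L i = begin
    combination (unit i) L  ≈⟨ sum-single +ᴹ-monoid (λ j → unit i j *ₗ L j) i (λ j i≢j →
                                 ≈ᴹ-trans (*ₗ-congʳ (reflexive (unit-other i j i≢j))) (*ₗ-zeroˡ (L j))) ⟩
    unit i i *ₗ L i         ≈⟨ *ₗ-congʳ (reflexive (unit-self i)) ⟩
    1# *ₗ L i               ≈⟨ *ₗ-identityˡ (L i) ⟩
    L i                     ∎

  *ₗ-neg : ∀ a x → a *ₗ x +ᴹ (- 1# * a) *ₗ x ≈ᴹ 0ᴹ
  *ₗ-neg a x = begin
    a *ₗ x +ᴹ (- 1# * a) *ₗ x       ≈⟨ *ₗ-distribʳ x a _ ⟨
    (a + - 1# * a) *ₗ x             ≈⟨ *ₗ-congʳ (+-congˡ (-1*x≈-x a)) ⟩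
    (a + - a) *ₗ x                  ≈⟨ *ₗ-congʳ (-‿inverseʳ a) ⟩
    0# *ₗ x                         ≈⟨ *ₗ-zeroˡ x ⟩
    0ᴹ                              ∎
    where open import Algebra.Properties.Ring ring using (-1*x≈-x)

  -1*ₗ-inverseʳ : ∀ x → x +ᴹ (- 1#) *ₗ x ≈ᴹ 0ᴹ
  -1*ₗ-inverseʳ x = begin
    x +ᴹ (- 1#) *ₗ x           ≈⟨ +ᴹ-congʳ (*ₗ-identityˡ x) ⟨
    1# *ₗ x +ᴹ (- 1#) *ₗ x     ≈⟨ *ₗ-distribʳ x 1# (- 1#) ⟨
    (1# + - 1#) *ₗ x           ≈⟨ *ₗ-congʳ (-‿inverseʳ 1#) ⟩
    0# *ₗ x                    ≈⟨ *ₗ-zeroˡ x ⟩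
    0ᴹ                         ∎

  -- Linear independence with respect to the weakened equality; unlike LinearlyIndependent
  -- it passes to L extended by any vector outside the span of L.
  Independent : ∀ {n} → (Fin n → Carrierᴹ) → Set (c ⊔ ℓ ⊔ ℓw)
  Independent L = ∀ γ → combination γ L ≈ᴹ 0ᴹ → ∀ i → γ i Stable.≈ 0#

  Independent-cons : ∀ {n} {L : Fin n → Carrierᴹ} {x} → Independent L → ¬ Span W L x →
                     Independent (x Functional.∷ L)
  Independent-cons {L = L} {x} L-indep x∉L γ γL≈0 = λ where
      zero    → γ₀≈0
      (suc i) → γ₀≈0 >>= λ γ₀≈0 → L-indep (γ ∘ suc) (begin
        combination (γ ∘ suc) L                       ≈⟨ +ᴹ-identityˡ _ ⟨
        0ᴹ +ᴹ combination (γ ∘ suc) L                 ≈⟨ +ᴹ-congʳ (≈ᴹ-trans (*ₗ-congʳ γ₀≈0) (*ₗ-zeroˡ x)) ⟨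
        γ zero *ₗ x +ᴹ combination (γ ∘ suc) L        ≈⟨ γL≈0 ⟩
        0ᴹ                                            ∎) i
    where
    γ₀≈0 : ¬ ¬ γ zero ≈ 0#
    γ₀≈0 γ₀≉0 = let a , γ₀a≈1 = inverse (γ zero) γ₀≉0 in
      x∉L ((λ i → (- 1# * a) * γ (suc i)) , (begin
        combination (λ i → (- 1# * a) * γ (suc i)) L     ≈⟨ combination-* L _ (γ ∘ suc) ⟩
        (- 1# * a) *ₗ y                                  ≈⟨ +ᴹ-identityˡ _ ⟨
        0ᴹ +ᴹ (- 1# * a) *ₗ y                            ≈⟨ +ᴹ-congʳ (≈ᴹ-trans (*ₗ-congˡ γL≈0) (*ₗ-zeroʳ a)) ⟨
        a *ₗ (γ zero *ₗ x +ᴹ y) +ᴹ (- 1# * a) *ₗ y       ≈⟨ +ᴹ-congʳ (*ₗ-distribˡ a _ _) ⟩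
        (a *ₗ (γ zero *ₗ x) +ᴹ a *ₗ y) +ᴹ (- 1# * a) *ₗ y ≈⟨ +ᴹ-assoc _ _ _ ⟩
        a *ₗ (γ zero *ₗ x) +ᴹ (a *ₗ y +ᴹ (- 1# * a) *ₗ y) ≈⟨ +ᴹ-cong (≈ᴹ-sym (*ₗ-assoc a _ x)) (*ₗ-neg a y) ⟩
        (a * γ zero) *ₗ x +ᴹ 0ᴹ                          ≈⟨ +ᴹ-identityʳ _ ⟩
        (a * γ zero) *ₗ x                                ≈⟨ *ₗ-congʳ (trans (*-comm a _) γ₀a≈1) ⟩
        1# *ₗ x                                          ≈⟨ *ₗ-identityˡ x ⟩
        x                                                ∎))
      where
      y = combination (γ ∘ suc) L

  -- The vectors of `b` keep known positions in `basis`, so their coordinates can be taken to be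
  -- unit vectors when `dimension-bound` compares `d` with the length of a generating list.
  record Extension {d} (b : Fin d → Carrierᴹ) (xs : List Carrierᴹ) : Set (c ⊔ ℓ ⊔ w ⊔ ℓw) where
    field
      {size}      : ℕ
      basis       : Fin size → Carrierᴹ
      independent : Independent basis
      position    : Fin d → Fin size
      injective   : Injective _≡_ _≡_ position
      extends     : ∀ i → basis (position i) ≡ b i
      spans       : All (Span W basis) xs

  extension : ∀ {d} (b : Fin d → Carrierᴹ) → LinearlyIndependent W b → ∀ xs → ¬ ¬ Extension b xs
  extension b b-indep [] = return record
    { basis = b ; independent = λ γ γb≈0 i → return (b-indep γ γb≈0 i) ; position = λ i → i
    ; injective = λ eq → eq ; extends = λ _ → ≡.refl ; spans = [] }
  extension b b-indep (x ∷ xs) = do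
    E ← extension b b-indep xs
    let open Extension E
    ¬¬-excluded-middle {A = Span W basis x} >>= λ where
      (yes x∈E) → return record
        { basis = basis ; independent = independent ; position = position
        ; injective = injective ; extends = extends ; spans = x∈E ∷ spans }
      (no x∉E) → return record
        { basis = x Functional.∷ basis ; independent = Independent-cons independent x∉E
        ; position = suc ∘ position ; injective = injective ∘ suc-injective ; extends = extends
        ; spans =
            (unit zero , combination-unit (x Functional.∷ basis) zero) ∷
            All.map (λ (γ , γE≈y) → 0# Functional.∷ γ ,
              ≈ᴹ-trans (+ᴹ-cong (*ₗ-zeroˡ x) γE≈y) (+ᴹ-identityˡ _)) spans }

  module _ {k} {L : Fin k → Carrierᴹ} (L-indep : Independent L) where

    coordinates-unique : ∀ {ξ ζ} → combination ξ L ≈ᴹ combination ζ L → ∀ p → ξ p Stable.≈ ζ p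
    coordinates-unique {ξ} {ζ} ξ≈ζ p = ¬¬-map
      (λ ξ-ζ≈0 → trans (+-inverseˡ-unique _ _ ξ-ζ≈0) (trans (-‿cong (-1*x≈-x _)) (-‿involutive _)))
      (L-indep (λ i → ξ i + - 1# * ζ i) (begin
        combination (λ i → ξ i + - 1# * ζ i) L                   ≈⟨ combination-+ L ξ (λ i → - 1# * ζ i) ⟩
        combination ξ L +ᴹ combination (λ i → - 1# * ζ i) L      ≈⟨ +ᴹ-cong ξ≈ζ (combination-* L (- 1#) ζ) ⟩
        combination ζ L +ᴹ (- 1#) *ₗ combination ζ L             ≈⟨ -1*ₗ-inverseʳ _ ⟩
        0ᴹ                                                       ∎) p)
      where open import Algebra.Properties.Ring ring using (-1*x≈-x; +-inverseˡ-unique; -‿involutive)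

    -- Evaluation of tensors in coordinates

    InSpan : Carrierᴹ → Set (c ⊔ ℓw)
    InSpan = Span W L

    -- The value of φ₁ ⊗ ... ⊗ φₘ at x₁ ⊗ ... ⊗ xₘ. Coordinates are read off the membership proofs;
    -- by independence of `L`, other proofs give the same value up to double negation.
    evalᵛ : ∀ {m} → Vec (Vector {k}) m → {xs : Vec Carrierᴹ m} → VecAll.All InSpan xs → Carrier
    evalᵛ []       []             = 1#
    evalᵛ (φ ∷ φs) ((ξ , _) ∷ ps) = φ • ξ * evalᵛ φs ps

    evalᵛ-cong : ∀ {m} (φs : Vec Vector m) {xs ys} → VecPointwise.Pointwise _≈ᴹ_ xs ys →
                 ∀ ps qs → evalᵛ φs {xs} ps Stable.≈ evalᵛ φs {ys} qs
    evalᵛ-cong []       []             []             []             = Stable.refl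
    evalᵛ-cong (φ ∷ φs) (x≈y ∷ xs≈ys) ((ξ , ξ≈x) ∷ ps) ((ζ , ζ≈y) ∷ qs) = Stable.*-cong
      (•-congʳ φ (coordinates-unique (≈ᴹ-trans ξ≈x (≈ᴹ-trans x≈y (≈ᴹ-sym ζ≈y)))))
      (evalᵛ-cong φs xs≈ys ps qs)

    evalᵛ-irrelevant : ∀ {m} (φs : Vec Vector m) {xs} ps qs → evalᵛ φs {xs} ps Stable.≈ evalᵛ φs qs
    evalᵛ-irrelevant φs = evalᵛ-cong φs (VecPointwise.refl ≈ᴹ-refl)

    evalᵛ-additive : ∀ {m} (φs : Vec Vector m) xs i x y ps qs rs →
      evalᵛ φs {xs [ i ]≔ (x +ᴹ y)} ps Stable.≈ evalᵛ φs {xs [ i ]≔ x} qs + evalᵛ φs {xs [ i ]≔ y} rs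
    evalᵛ-additive (φ ∷ φs) (_ ∷ xs) zero x y ((ξ , ξ≈x+y) ∷ ps) ((ζ , ζ≈x) ∷ qs) ((η , η≈y) ∷ rs) =
      Stable.trans (Stable.*-congʳ (Stable.trans
        (•-congʳ φ (coordinates-unique (≈ᴹ-trans ξ≈x+y (≈ᴹ-sym
          (≈ᴹ-trans (combination-+ L ζ η) (+ᴹ-cong ζ≈x η≈y))))))
        (•-additiveʳ φ ζ η)))
      (Stable.trans (Stable.distribʳ _ _ _)
        (Stable.+-cong (Stable.*-congˡ (evalᵛ-irrelevant φs ps qs)) (Stable.*-congˡ (evalᵛ-irrelevant φs ps rs))))
    evalᵛ-additive (φ ∷ φs) (_ ∷ xs) (suc i) x y ((ξ , ξ≈) ∷ ps) ((ζ , ζ≈) ∷ qs) ((η , η≈) ∷ rs) =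
      Stable.trans (Stable.*-congˡ (evalᵛ-additive φs xs i x y ps qs rs))
      (Stable.trans (Stable.distribˡ _ _ _)
        (Stable.+-cong (Stable.*-congʳ (•-congʳ φ (coordinates-unique (≈ᴹ-trans ξ≈ (≈ᴹ-sym ζ≈)))))
                       (Stable.*-congʳ (•-congʳ φ (coordinates-unique (≈ᴹ-trans ξ≈ (≈ᴹ-sym η≈)))))))

    evalᵛ-homogeneous : ∀ {m} (φs : Vec Vector m) xs i a x ps qs →
      evalᵛ φs {xs [ i ]≔ (a *ₗ x)} ps Stable.≈ a * evalᵛ φs {xs [ i ]≔ x} qs
    evalᵛ-homogeneous (φ ∷ φs) (_ ∷ xs) zero a x ((ξ , ξ≈ax) ∷ ps) ((ζ , ζ≈x) ∷ qs) =
      Stable.trans (Stable.*-cong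
        (Stable.trans
          (•-congʳ φ (coordinates-unique (≈ᴹ-trans ξ≈ax (≈ᴹ-sym (≈ᴹ-trans (combination-* L a ζ) (*ₗ-congˡ ζ≈x))))))
          (•-homogeneousʳ φ a ζ))
        (evalᵛ-irrelevant φs ps qs))
      (Stable.*-assoc _ _ _)
    evalᵛ-homogeneous (φ ∷ φs) (_ ∷ xs) (suc i) a x ((ξ , ξ≈) ∷ ps) ((ζ , ζ≈) ∷ qs) =
      Stable.trans (Stable.*-cong (•-congʳ φ (coordinates-unique (≈ᴹ-trans ξ≈ (≈ᴹ-sym ζ≈))))
                                  (evalᵛ-homogeneous φs xs i a x ps qs))
      (x∙yz≈y∙xz _ _ _)
      where open import Algebra.Properties.CommutativeSemigroup Stable.*-commutativeSemigroup using (x∙yz≈y∙xz)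

    evalᵗ : ∀ {m} → Vec (Vector {k}) m → (t : Tensor W m) → Supported W InSpan t → Carrier
    evalᵗ φs (⨂ xs)  ps        = evalᵛ φs ps
    evalᵗ φs 𝟘       _         = 0#
    evalᵗ φs (s ⊕ t) (ps , pt) = evalᵗ φs s ps + evalᵗ φs t pt
    evalᵗ φs (a ⊙ t) pt        = a * evalᵗ φs t pt

    evalᵗ-irrelevant : ∀ {m} (φs : Vec Vector m) t p q → evalᵗ φs t p Stable.≈ evalᵗ φs t q
    evalᵗ-irrelevant φs (⨂ xs)  p         q         = evalᵛ-irrelevant φs p q
    evalᵗ-irrelevant φs 𝟘       p         q         = Stable.refl
    evalᵗ-irrelevant φs (s ⊕ t) (ps , pt) (qs , qt) =
      Stable.+-cong (evalᵗ-irrelevant φs s ps qs) (evalᵗ-irrelevant φs t pt qt)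
    evalᵗ-irrelevant φs (a ⊙ t) p         q         = Stable.*-congˡ (evalᵗ-irrelevant φs t p q)

    -- Products of functionals are multilinear, so each rule preserves the value. The middle tensor
    -- of `≋-trans` has coordinates because its vectors are among the `intermediates`.
    evalᵗ-resp : ∀ {m} (φs : Vec Vector m) {s t} (s≋t : _≋_ W s t) → All InSpan (intermediates W s≋t) →
                 ∀ p q → evalᵗ φs s p Stable.≈ evalᵗ φs t q
    evalᵗ-resp φs {s} ≋-refl _ p q = evalᵗ-irrelevant φs s p q
    evalᵗ-resp φs (≋-sym d) i p q = Stable.sym (evalᵗ-resp φs d i q p)
    evalᵗ-resp φs (≋-trans {t = t} d e) i p q =
      let it , ide = All.++⁻ (vectors W t) i
          id , ie  = All.++⁻ (intermediates W d) ide
          pt       = Supported-vectors W t it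
      in Stable.trans (evalᵗ-resp φs d id p pt) (evalᵗ-resp φs e ie pt q)
    evalᵗ-resp φs (⨂-cong xs≈ys) _ p q = evalᵛ-cong φs xs≈ys p q
    evalᵗ-resp φs (⊕-cong d e) i (ps , pt) (qs , qt) =
      let id , ie = All.++⁻ (intermediates W d) i
      in Stable.+-cong (evalᵗ-resp φs d id ps qs) (evalᵗ-resp φs e ie pt qt)
    evalᵗ-resp φs (⊙-cong a≈b d) i p q = Stable.*-cong (return a≈b) (evalᵗ-resp φs d i p q)
    evalᵗ-resp φs (⊕-assoc s t u) _ ((ps , pt) , pu) q =
      Stable.trans (Stable.+-assoc _ _ _) (evalᵗ-irrelevant φs (s ⊕ (t ⊕ u)) (ps , pt , pu) q)
    evalᵗ-resp φs (⊕-comm s t) _ (ps , pt) q =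
      Stable.trans (Stable.+-comm _ _) (evalᵗ-irrelevant φs (t ⊕ s) (pt , ps) q)
    evalᵗ-resp φs (⊕-identityˡ s) _ (_ , p) q = Stable.trans (Stable.+-identityˡ _) (evalᵗ-irrelevant φs s p q)
    evalᵗ-resp φs (⊙-zeroˡ s) _ p q = Stable.zeroˡ _
    evalᵗ-resp φs (⊙-zeroʳ a) _ p q = Stable.zeroʳ a
    evalᵗ-resp φs (⊙-identityˡ s) _ p q = Stable.trans (Stable.*-identityˡ _) (evalᵗ-irrelevant φs s p q)
    evalᵗ-resp φs (⊙-assoc a b s) _ p q =
      Stable.trans (Stable.*-assoc a b _) (evalᵗ-irrelevant φs (a ⊙ (b ⊙ s)) p q)
    evalᵗ-resp φs (⊙-distribˡ a s t) _ (ps , pt) q =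
      Stable.trans (Stable.distribˡ a _ _) (evalᵗ-irrelevant φs (a ⊙ s ⊕ a ⊙ t) (ps , pt) q)
    evalᵗ-resp φs (⊙-distribʳ s a b) _ p q =
      Stable.trans (Stable.distribʳ _ a b) (evalᵗ-irrelevant φs (a ⊙ s ⊕ b ⊙ s) (p , p) q)
    evalᵗ-resp φs (⨂-additive xs i x y) _ p (q , r) = evalᵛ-additive φs xs i x y p q r
    evalᵗ-resp φs (⨂-homogeneous xs i a x) _ p q = evalᵛ-homogeneous φs xs i a x p q

    -- Power sums as lists of terms

    terms : ∀ {n} → (Fin n → Carrier) → {v : Fin n → Carrierᴹ} → (∀ a → InSpan (v a)) → List (Term {k})
    terms α V = tabulate λ a → α a , proj₁ (V a)

    module _ (m : ℕ) where

      powers-supported : ∀ {n} (α : Fin n → Carrier) {v : Fin n → Carrierᴹ} → (∀ a → InSpan (v a)) →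
                         Supported W InSpan (∑ (TensorPower W m) (scaledPowers W m α v))
      powers-supported {zero}  α V = lift tt
      powers-supported {suc n} α V = All-replicate⁺ m (V zero) , powers-supported (α ∘ suc) (V ∘ suc)

      evalᵛ-replicate : ∀ {m} (φs : Vec Vector m) {x} (p : InSpan x) →
                        evalᵛ φs (All-replicate⁺ m p) ≡ eval φs (proj₁ p)
      evalᵛ-replicate []       p = ≡.refl
      evalᵛ-replicate (φ ∷ φs) p = ≡.cong (φ • proj₁ p *_) (evalᵛ-replicate φs p)

      evalᵗ-powers : ∀ φs {n} (α : Fin n → Carrier) {v : Fin n → Carrierᴹ} (V : ∀ a → InSpan (v a)) →
        evalᵗ φs (∑ (TensorPower W m) (scaledPowers W m α v)) (powers-supported α V) ≡ total φs (terms α V)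
      evalᵗ-powers φs {zero}  α V = ≡.refl
      evalᵗ-powers φs {suc n} α V =
        ≡.cong₂ (λ x y → α zero * x + y) (evalᵛ-replicate φs (V zero)) (evalᵗ-powers φs (α ∘ suc) (V ∘ suc))

      tensor : Term → Tensor W m
      tensor (γ , ξ) = γ ⊙ _^⊗_ W (combination ξ L) m

      tensor-~ : ∀ {s t} → _~_ m s t → ¬ ¬ _≋_ W (tensor s) (tensor t)
      tensor-~ {α , ξ} {β , ζ} (μ , ζ≈μξ , α≈βμᵐ) = do
        ζ≈μξ  ← ¬¬-∀Fin ζ≈μξ
        α≈βμᵐ ← α≈βμᵐ
        return (≋-trans (⊙-cong α≈βμᵐ ≋-refl) (≋-trans (⊙-assoc _ _ _) (⊙-cong refl (≋-sym
          (≋-trans (^⊗-cong W m (≈ᴹ-trans (combination-cong L ζ≈μξ) (combination-* L μ ξ)))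
          (≋-trans (^⊗-homogeneous W m μ (combination ξ L)) (⊙-cong (reflexive (^-stable μ m)) ≋-refl)))))))

      tensors-~ : ∀ {ss ts} → Pointwise (_~_ m) ss ts → ¬ ¬ Pointwise (_≋_ W) (map tensor ss) (map tensor ts)
      tensors-~ []       = return []
      tensors-~ (p ∷ ps) = do
        q  ← tensor-~ p
        qs ← tensors-~ ps
        return (q ∷ qs)

      tensor-terms : ∀ {n} (α : Fin n → Carrier) {v : Fin n → Carrierᴹ} (V : ∀ a → InSpan (v a)) →
        Pointwise (_≋_ W) (tabulate (scaledPowers W m α v)) (map tensor (terms α V))
      tensor-terms {zero}  α V = []
      tensor-terms {suc n} α V =
        ⊙-cong refl (^⊗-cong W m (≈ᴹ-sym (proj₂ (V zero)))) ∷ tensor-terms (α ∘ suc) (V ∘ suc)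

      -- Leads from coordinates back to tensors over W. The weakened equations leave a double
      -- negation, which is harmless because the result serves only to contradict the difference of
      -- the multisets.
      ~⇒SameMultiset : ∀ {n r} (α : Fin n → Carrier) {v : Fin n → Carrierᴹ} (V : ∀ a → InSpan (v a))
        (β : Fin r → Carrier) {u : Fin r → Carrierᴹ} (U : ∀ a → InSpan (u a)) {zs} →
        terms β U ↭ zs → Pointwise (_~_ m) (terms α V) zs →
        ¬ ¬ SameMultiset (Module.≈ᴹ-setoid (TensorPower W m)) (scaledPowers W m α v) (scaledPowers W m β u)
      ~⇒SameMultiset α V β U ys↭zs xs~zs = do
        xs≋zs ← tensors-~ xs~zs
        return (Homogeneous.trans (Homogeneous.refl (tensor-terms α V))
               (Homogeneous.trans (Homogeneous.refl xs≋zs)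
               (Homogeneous.trans (↭⇒↭ₛ′ (Module.≈ᴹ-isEquivalence (TensorPower W m)) (map⁺ tensor (↭-sym ys↭zs)))
               (Homogeneous.refl (Pointwise.symmetric ≋-sym (tensor-terms β U))))))

    -- Independence and dimension in coordinates

    ∦-coordinates : ∀ {x y} ((ξ , _) : InSpan x) ((ζ , _) : InSpan y) →
                    (∀ μ → ¬ y ≈ᴹ μ *ₗ x) → ¬ (ζ ∥ ξ)
    ∦-coordinates (ξ , ξ≈x) (ζ , ζ≈y) y∦x (μ , ζ≈μξ) = ¬¬-∀Fin ζ≈μξ λ ζ≈μξ → y∦x μ
      (≈ᴹ-trans (≈ᴹ-sym ζ≈y) (≈ᴹ-trans (combination-cong L ζ≈μξ)
        (≈ᴹ-trans (combination-* L μ ξ) (*ₗ-congˡ ξ≈x))))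

    nonzero-coordinates : ∀ {x} ((ξ , _) : InSpan x) → NonZeroVector W x → Nonzero ξ
    nonzero-coordinates (ξ , ξ≈x) x≉0 = Nonzero-intro λ ξ≈0 → ¬¬-∀Fin ξ≈0 λ ξ≈0 → x≉0
      (≈ᴹ-trans (≈ᴹ-sym ξ≈x) (sum-zero +ᴹ-monoid (λ i → ξ i *ₗ L i) λ i →
        ≈ᴹ-trans (*ₗ-congʳ (ξ≈0 i)) (*ₗ-zeroˡ (L i))))

    Span-annihilated : ∀ {n} {v : Fin n → Carrierᴹ} (V : ∀ a → InSpan (v a)) ψ →
      (∀ a → ψ • proj₁ (V a) Stable.≈ 0#) → ∀ {x} → Span W v x → ((ξ , _) : InSpan x) → ψ • ξ Stable.≈ 0#
    -- `go` assembles coordinates of the combination from those of the `v a`; by uniqueness they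
    -- agree with the given coordinates `ξ` of `x`.
    Span-annihilated V ψ ψV≈0 (γ , γv≈x) (ξ , ξ≈x) = let ζ , ζ≈γv , ψζ≈0 = go V ψV≈0 γ in
      Stable.trans (•-congʳ ψ (coordinates-unique (≈ᴹ-trans ξ≈x (≈ᴹ-sym (≈ᴹ-trans ζ≈γv γv≈x))))) ψζ≈0
      where
      go : ∀ {n} {v : Fin n → Carrierᴹ} (V : ∀ a → InSpan (v a)) → (∀ a → ψ • proj₁ (V a) Stable.≈ 0#) →
           ∀ γ → ∃[ ζ ] combination ζ L ≈ᴹ combination γ v × ψ • ζ Stable.≈ 0#
      go {zero}  V ψV≈0 γ = (λ _ → 0#) , sum-zero +ᴹ-monoid (λ i → 0# *ₗ L i) (λ i → *ₗ-zeroˡ (L i)) , •-zeroʳ ψ (λ _ → Stable.refl)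
      go {suc n} V ψV≈0 γ =
        let ζ , ζ≈γv , ψζ≈0 = go (V ∘ suc) (ψV≈0 ∘ suc) (γ ∘ suc)
            ξ , ξ≈v₀ = V zero
        in (λ p → γ zero * ξ p + ζ p)
         , ≈ᴹ-trans (combination-+ L _ ζ) (+ᴹ-cong (≈ᴹ-trans (combination-* L _ ξ) (*ₗ-congˡ ξ≈v₀)) ζ≈γv)
         , Stable.trans (•-additiveʳ ψ _ ζ) (Stable.trans (Stable.+-cong
             (Stable.trans (•-homogeneousʳ ψ _ ξ) (Stable.trans (Stable.*-congˡ (ψV≈0 zero)) (Stable.zeroʳ _))) ψζ≈0)
             (Stable.+-identityʳ 0#))

    -- The hypothesis on `xs` says in dual form that `xs` generates the coordinates of all `v a`. If
    -- `xs` had fewer than `d` members, some `ψ` would kill `xs` but not the unit vector of some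
    -- `b i`, although `b i` lies in the span of `v`, where `ψ` vanishes.
    dimension-bound : ∀ {d} {b : Fin d → Carrierᴹ} (j : Fin d → Fin k) → Injective _≡_ _≡_ j → (∀ i → L (j i) ≡ b i) →
      ∀ {n} {v : Fin n → Carrierᴹ} (V : ∀ a → InSpan (v a)) → (∀ i → Span W v (b i)) →
      (xs : List Vector) → (∀ ψ → All (λ x → ψ • x Stable.≈ 0#) xs → ∀ a → ψ • proj₁ (V a) Stable.≈ 0#) →
      d ℕ.≤ length xs
    dimension-bound {d} {b} j j-inj Lj≡b V b∈v xs xs-span = decidable-stable (_ ℕ.≤? _) λ d≰xs →
      annihilator xs (unit ∘ j) (unit ∘ j) (diagonal , off-diagonal) (ℕ.≰⇒> d≰xs)
        λ (ψ , (i , ψi≉0) , ψxs≈0 , _) → ψi≉0 (Span-annihilated V ψ (xs-span ψ ψxs≈0) (b∈v i)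
          (unit (j i) , ≈ᴹ-trans (combination-unit L (j i)) (≈ᴹ-reflexive (Lj≡b i))))
      where
      diagonal : ∀ i → unit (j i) • unit (j i) Stable.≉ 0#
      diagonal i eq = Stable.1≉0 (Stable.trans (Stable.reflexive (≡.sym (unit-self (j i))))
        (Stable.trans (Stable.sym (unit-• (j i) (unit (j i)))) eq))
      off-diagonal : ∀ i i′ → i ≢ i′ → unit (j i) • unit (j i′) Stable.≈ 0#
      off-diagonal i i′ i≢i′ = Stable.trans (unit-• (j i) (unit (j i′)))
        (Stable.reflexive (unit-other (j i′) (j i) (i≢i′ ∘ ≡.sym ∘ j-inj)))

    terms-⋕ : ∀ {n} (α : Fin n → Carrier) {v : Fin n → Carrierᴹ} (V : ∀ a → InSpan (v a)) →
              (∀ a → NonZeroVector W (v a)) → (∀ {a b} → a ≢ b → ∀ μ → ¬ v b ≈ᴹ μ *ₗ v a) →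
              AllPairs _⋕ₜ_ (terms α V)
    terms-⋕ α V v≉0 v∦ = AllPairs.tabulate⁺ λ {a} {b} a≢b → ∦⇒⋕
      (nonzero-coordinates (V a) (v≉0 a)) (nonzero-coordinates (V b) (v≉0 b)) (∦-coordinates (V a) (V b) (v∦ a≢b))

  -- Kruskal rank and the final bound

  -- Independence is given for subfamilies of size `k`, so the pair `b`, `a` is completed to `k`
  -- distinct indices. The coefficients 1, -μ, 0, ..., 0 would then form a non-trivial relation.
  Kruskal⇒∦ : ∀ {n} {v : Fin n → Carrierᴹ} k → 2 ℕ.≤ k → SubfamiliesIndependent W v k →
              ∀ {a b} → a ≢ b → ∀ μ → ¬ v b ≈ᴹ μ *ₗ v a
  Kruskal⇒∦ {suc zero} _ _ _ {zero} {zero} a≢b = contradiction ≡.refl a≢b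
  Kruskal⇒∦ {suc (suc n)} {v} (suc (suc k)) (s≤s (s≤s _)) (s≤s (s≤s k≤n) , independent) {a} {b} a≢b μ vb≈μva =
    1≉0 (independent f f-injective γ (begin
      1# *ₗ v b +ᴹ ((- 1# * μ) *ₗ v (punchIn b a′) +ᴹ y)
        ≈⟨ +ᴹ-cong (*ₗ-identityˡ (v b)) (+ᴹ-cong (≡.subst (λ i → (- 1# * μ) *ₗ v (punchIn b a′) ≈ᴹ (- 1# * μ) *ₗ v i)
             (punchIn-punchOut b≢a) ≈ᴹ-refl) (sum-zero +ᴹ-monoid (λ i → 0# *ₗ v (f (suc (suc i)))) (λ i → *ₗ-zeroˡ _))) ⟩
      v b +ᴹ ((- 1# * μ) *ₗ v a +ᴹ 0ᴹ)        ≈⟨ +ᴹ-cong vb≈μva (+ᴹ-identityʳ _) ⟩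
      μ *ₗ v a +ᴹ (- 1# * μ) *ₗ v a           ≈⟨ *ₗ-neg μ (v a) ⟩
      0ᴹ                                      ∎) zero)
    where
    b≢a : b ≢ a
    b≢a = a≢b ∘ ≡.sym
    a′ : Fin (suc n)
    a′ = punchOut b≢a
    -- `punchIn i` skips `i`, so that putting `i` in front keeps a family injective. In `f` this is
    -- done for `a` and then for `b`, where `a′` is the index of `a` once `b` is left out.
    cons : ∀ {j n} → Fin (suc n) → (Fin j → Fin n) → Fin (suc j) → Fin (suc n)
    cons i g zero    = i
    cons i g (suc j) = punchIn i (g j)
    cons-injective : ∀ {j n} (i : Fin (suc n)) (g : Fin j → Fin n) → Injective _≡_ _≡_ g → Injective _≡_ _≡_ (cons i g)
    cons-injective i g g-inj {zero}  {zero}  eq = ≡.refl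
    cons-injective i g g-inj {zero}  {suc t} eq = contradiction (≡.sym eq) (punchInᵢ≢i i (g t))
    cons-injective i g g-inj {suc s} {zero}  eq = contradiction eq (punchInᵢ≢i i (g s))
    cons-injective i g g-inj {suc s} {suc t} eq = ≡.cong suc (g-inj (punchIn-injective i (g s) (g t) eq))
    f : Fin (suc (suc k)) → Fin (suc (suc n))
    f = cons b (cons a′ (λ t → inject≤ t k≤n))
    f-injective : Injective _≡_ _≡_ f
    f-injective = cons-injective b _ (cons-injective a′ _ λ {s} {t} → inject≤-injective k≤n k≤n s t)
    γ : Fin (suc (suc k)) → Carrier
    γ zero          = 1#
    γ (suc zero)    = - 1# * μ
    γ (suc (suc _)) = 0#
    y : Carrierᴹ
    y = combination {k} (λ _ → 0#) (λ i → v (f (suc (suc i))))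

  power-sums-size : ∀ m {n r d} {v : Fin n → Carrierᴹ} {u : Fin r → Carrierᴹ}
    {α : Fin n → Carrier} {β : Fin r → Carrier} →
    (∀ a → NonZeroVector W (v a)) → (∀ {a b} → a ≢ b → ∀ μ → ¬ v b ≈ᴹ μ *ₗ v a) →
    (∀ a → NonZeroVector W (u a)) → (∀ {a b} → a ≢ b → ∀ μ → ¬ u b ≈ᴹ μ *ₗ u a) →
    (∀ a → α a ≉ 0#) → (∀ a → β a ≉ 0#) → HasDimension W (Span W v) d →
    ¬ SameMultiset (Module.≈ᴹ-setoid (TensorPower W (2 ℕ.+ m)))
        (scaledPowers W (2 ℕ.+ m) α v) (scaledPowers W (2 ℕ.+ m) β u) →
    _≋_ W (∑ (TensorPower W (2 ℕ.+ m)) (scaledPowers W (2 ℕ.+ m) α v))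
          (∑ (TensorPower W (2 ℕ.+ m)) (scaledPowers W (2 ℕ.+ m) β u)) →
    m ℕ.+ 2 ℕ.* d ℕ.≤ n ℕ.+ r
  power-sums-size m {n} {r} {d} {v} {u} {α} {β} v≉0 v∦ u≉0 u∦ α≉0 β≉0 (b , b-basis) different equal =
    decidable-stable (_ ℕ.≤? _) do
      -- Starting from the given basis `b`, the extension covers all vectors of both sums and of the
      -- derivation `equal`, so that each of them has coordinates.
      E ← extension b (IsBasisOf.independent b-basis) (tabulate v ++ (tabulate u ++ intermediates W equal))
      let open Extension E using (position; injective; extends) renaming (independent to L-indep)
          v∈L , rest∈L  = All.++⁻ (tabulate v) (Extension.spans E)
          u∈L , equal∈L = All.++⁻ (tabulate u) rest∈L
          V = All.tabulate⁻ v∈L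
          U = All.tabulate⁻ u∈L
          xs = terms L-indep α V
          ys = terms L-indep β U
          V≉0 : All (Nonzero ∘ proj₂) xs
          V≉0 = All.tabulate⁺ λ a → nonzero-coordinates L-indep (V a) (v≉0 a)
          U≉0 : All (Nonzero ∘ proj₂) ys
          U≉0 = All.tabulate⁺ λ a → nonzero-coordinates L-indep (U a) (u≉0 a)
      D ← difference (2 ℕ.+ m) xs ys
            (terms-⋕ L-indep α V v≉0 v∦) V≉0 (All.tabulate⁺ λ a → return (α≉0 a))
            (terms-⋕ L-indep β U u≉0 u∦) U≉0 (All.tabulate⁺ λ a → return (β≉0 a))
      let open Difference D hiding (spans)
      S ← select rest
      let open Selection S using (chosen)
          -- `total-rest` gives `rest` plus `ys` the value of `xs`, which is the value of `ys` by
          -- `equal`; cancelling `ys` leaves zero.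
          relation = λ φs → +-identityˡ-unique _ _ (Stable.trans (total-rest φs)
            (Stable.trans (Stable.reflexive (≡.sym (evalᵗ-powers L-indep (2 ℕ.+ m) φs α V)))
            (Stable.trans (evalᵗ-resp L-indep φs equal equal∈L _ _)
              (Stable.reflexive (evalᵗ-powers L-indep (2 ℕ.+ m) φs β U)))))
          rest≢[] = λ rest≡[] → let zs , ys↭zs , xs~zs = matched rest≡[] in
            ~⇒SameMultiset L-indep (2 ℕ.+ m) α V β U ys↭zs xs~zs different
          rest-size = relation-size m S (chosen-nonempty S rest≢[] (inherit Nonzero V≉0 U≉0)) pairwise coefficients relation
          -- The D chosen and the s cancelled vectors together generate all of `v`, which yields d ≤
          -- D + s.
          d-bound = dimension-bound L-indep position injective extends V (IsBasisOf.member b-basis)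
            (map proj₂ chosen ++ cancelled) λ ψ ψ≈0 →
              let ψchosen≈0 , ψcancelled≈0 = All.++⁻ (map proj₂ chosen) ψ≈0 in
              All.tabulate⁻ (Difference.spans D ψ (Selection.spans S ψ (All.map⁻ ψchosen≈0)) ψcancelled≈0)
      return (≡.subst (m ℕ.+ 2 ℕ.* d ℕ.≤_)
        (≡.cong₂ ℕ._+_ (length-tabulate (λ a → α a , proj₁ (V a))) (length-tabulate (λ a → β a , proj₁ (U a))))
        (size-bound m (length chosen) (length cancelled)
          (≡.subst (d ℕ.≤_)
            (≡.trans (length-++ (map proj₂ chosen)) (≡.cong (ℕ._+ length cancelled) (length-map proj₂ chosen))) d-bound)
          rest-size size))
    where
    open import Algebra.Properties.Ring Stable.ring using (+-identityˡ-unique)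

open import Data.Nat.Base using (_+_; _*_)
open Field using (Carrier)
open Module using (Carrierᴹ; ≈ᴹ-setoid)

theorem9p1 : ∀ {c ℓ w ℓw} (n m : ℕ) → n ≥ 2 → m ≥ 2 →
    (F : Field c ℓ) (W : VectorSpace F w ℓw) →
    (p : ℕ) → IsCharacteristic F p → p ≡ 0 ⊎ p > m →
    (v : Fin n → Carrierᴹ W) → (∀ a → NonZeroVector W (v a)) →
    (k : ℕ) → IsKruskalRank W v k → k ≥ 2 →
    (d : ℕ) → HasDimension W (Span W v) d →
    (r : ℕ) (u : Fin r → Carrierᴹ W) → (∀ a → NonZeroVector W (u a)) →
    (l : ℕ) → IsKruskalRank W u l → l ≥ 2 ⊓ r →
    (α : Fin n → Carrier F) → (∀ a → NonZeroScalar F (α a)) →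
    (β : Fin r → Carrier F) → (∀ a → NonZeroScalar F (β a)) →
    ¬ SameMultiset (≈ᴹ-setoid (TensorPower W m)) (scaledPowers W m α v) (scaledPowers W m β u) →
    _≋_ W (∑ (TensorPower W m) (scaledPowers W m α v)) (∑ (TensorPower W m) (scaledPowers W m β u)) →
    n + r ≥ m + 2 * d ∸ 2
-- For degree `suc (suc m)` the subtraction of 2 in the conclusion computes away.
theorem9p1 n (suc (suc m)) _ (s≤s (s≤s _)) F W _ _ _ v v≉0 k v-rank k≥2 d dim r u u≉0 l u-rank l≥2⊓r α α≉0 β β≉0 =
  power-sums-size m v≉0 (Kruskal⇒∦ k k≥2 (IsKruskalRank.holds v-rank))
    -- Two distinct indices exist only if `r` is at least 2, and then `2 ⊓ r` equals 2.
    u≉0 (λ a≢b → Kruskal⇒∦ l (ℕ.≤-trans (ℕ.≤-reflexive (≡.sym (ℕ.m≤n⇒m⊓n≡m (distinct⇒2≤ a≢b)))) l≥2⊓r)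
                   (IsKruskalRank.holds u-rank) a≢b)
    α≉0 β≉0 dim
  where
  open Coordinates F W
  distinct⇒2≤ : ∀ {r} {a b : Fin r} → a ≢ b → 2 ℕ.≤ r
  distinct⇒2≤ {suc zero}    {zero} {zero} a≢b = contradiction ≡.refl a≢b
  distinct⇒2≤ {suc (suc r)} _ = s≤s (s≤s z≤n)
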